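{- Let $B$ be a singleton board with $n$ columns, padded with columns of height zero on the left so that $\xi_m(B)=\langle z_1,\ldots,z_n\rangle$ has only non-negative entries. For each integer $k$ let $v_k$ be the number of entries of $\xi_m(B)$ equal to $k$, and let $M$ be the greatest integer with $v_M\ne0$. Let $S$ be the set of non-negative multiples of $m$ strictly less than $M$. Let $i$ be the least non-negative integer such that either $v_i>1$, or both $v_i=1$ and $i$ is not a multiple of $m$. Then the $m$-level rook equivalence graph $G_m(B)$ is connected if and only if $v_s\ge2$ for all $s\in S$ with $s>i$.
   Context: Fix an integer $m>0$. A Ferrers board is given by a weakly increasing sequence of non-negative integers $B=(b_1,\ldots,b_n)$ of column heights (cells in column $i$, rows $1,\ldots,b_i$, of the first quadrant); prepending height-$0$ columns on the left does not change the board, and boards are compared with the same number of columns by such padding. The rows are partitioned into levels: level $t$ consists of rows $(t-1)m+1,\ldots,tm$. An $m$-level rook placement of $k$ rooks is a set of $k$ cells of $B$, no two in the same level or the same column; $r_{k,m}(B)$ is their number, and two boards are $m$-level rook equivalent if they have equal $r_{k,m}$ for all $k\ge0$. For an integer $o$, $\lfloor o\rfloor_m$ is the largest multiple of $m$ that is $\le o$. $B$ is singleton if for each $i<n$, $b_i-\lfloor b_i\rfloor_m\ne0$ implies $\lfloor b_i\rfloor_m<\lfloor b_{i+1}\rfloor_m$. The $m$-level root vector of $B$ is $\xi_m(B)=\langle 0-b_1,m-b_2,\ldots,m(n-1)-b_n\rangle$. The $m$-level rook equivalence graph $G_m(B)$ of a singleton board $B$ has as vertices all singleton boards $m$-level rook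 equivalent to $B$, and $\{B_1,B_2\}$ is an edge iff, written with the same number of columns, $B_1$ and $B_2$ differ in exactly two columns $i,j$, where $B_1$ has $k$ more cells than $B_2$ in column $i$ and $k$ fewer in column $j$, for some $k>0$. -}

module Defs where

open import Data.Fin.Base using (Fin; toℕ)
import Data.Fin.Properties as Fin
open import Data.Integer.Base as ℤ using (ℤ; +_)
import Data.Integer.Properties as ℤ
open import Data.List.Base as List using (List; []; _∷_; _++_; length; filter; concatMap; upTo; allFin)
open import Data.List.Relation.Unary.AllPairs as AllPairs using (AllPairs)
open import Data.Nat.Base using (ℕ; _+_; _*_; _∸_; _≤_; _<_; NonZero)
open import Data.Nat.DivMod using (_/_)
open import Data.Nat.Divisibility using (_∣_)
open import Data.Nat.Properties using (_≟_)
open import Data.Product.Base using (_×_; _,_; ∃-syntax; Σ-syntax)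
open import Data.Sum.Base using (_⊎_)
open import Data.Vec.Base as Vec using (Vec; _∷_; lookup; tabulate)
open import Data.Vec.Relation.Unary.Linked using (Linked)
open import Level using (0ℓ)
open import Relation.Binary.Construct.Closure.ReflexiveTransitive using (Star)
open import Relation.Binary.Core using (Rel)
open import Relation.Binary.PropositionalEquality.Core using (_≡_; _≢_)
open import Relation.Nullary.Decidable using (Dec; ¬?; _×-dec_)
open import Relation.Unary using (Pred; Decidable)

IsGreatest : Pred ℤ 0ℓ → ℤ → Set
IsGreatest P x = P x × (∀ y → P y → y ℤ.≤ x)

IsLeast : Pred ℕ 0ℓ → ℕ → Set
IsLeast P x = P x × (∀ y → P y → x ≤ y)

subsets : ∀ {A : Set} → List A → List (List A)
subsets []       = [] ∷ []
subsets (x ∷ xs) = List.map (x ∷_) (subsets xs) ++ subsets xs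

record Board (n : ℕ) : Set where
  field
    heights    : Vec ℕ n
    increasing : Linked _≤_ heights

open Board public

infix 4 _⊑₀_ _≋_

-- xs ⊑₀ ys: ys is xs with zeros prepended.
data _⊑₀_ {n} (xs : Vec ℕ n) : ∀ {N} → Vec ℕ N → Set where
  same : xs ⊑₀ xs
  pad  : ∀ {N} {ys : Vec ℕ N} → xs ⊑₀ ys → xs ⊑₀ (0 ∷ ys)

_≋_ : ∀ {n₁ n₂} → Board n₁ → Board n₂ → Set
B₁ ≋ B₂ = ∃[ N ] Σ[ C ∈ Vec ℕ N ] heights B₁ ⊑₀ C × heights B₂ ⊑₀ C

-- Rows are counted from 0, so that level t, rows (t - 1) m + 1, …, t m when
-- counted from 1, consists of the rows r with r / m = t - 1.
Cell : ℕ → Set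
Cell n = Fin n × ℕ

cells : ∀ {n} → Board n → List (Cell n)
cells {n} B = concatMap (λ i → List.map (i ,_) (upTo (lookup (heights B) i))) (allFin n)

module _ (m : ℕ) .{{_ : NonZero m}} where

  ⌊_⌋ₘ : ℕ → ℕ
  ⌊ o ⌋ₘ = (o / m) * m

  Singleton : ∀ {n} → Board n → Set
  Singleton B = Linked (λ b b′ → b ∸ ⌊ b ⌋ₘ ≢ 0 → ⌊ b ⌋ₘ < ⌊ b′ ⌋ₘ) (heights B)

  NonAttacking : ∀ {n} → Cell n → Cell n → Set
  NonAttacking (i , r) (j , s) = i ≢ j × r / m ≢ s / m

  nonAttacking? : ∀ {n} (c d : Cell n) → Dec (NonAttacking c d)
  nonAttacking? (i , r) (j , s) = ¬? (i Fin.≟ j) ×-dec ¬? (r / m ≟ s / m)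

  IsPlacement : ∀ {n} → ℕ → List (Cell n) → Set
  IsPlacement k P = length P ≡ k × AllPairs NonAttacking P

  isPlacement? : ∀ {n} k → Decidable (IsPlacement {n} k)
  isPlacement? k P = (length P ≟ k) ×-dec AllPairs.allPairs? nonAttacking? P

  -- cells B has no repetitions, so each set of cells of B occurs exactly once
  -- in subsets (cells B).
  r : ∀ {n} → ℕ → Board n → ℕ
  r k B = length (filter (isPlacement? k) (subsets (cells B)))

  RookEquivalent : ∀ {n₁ n₂} → Board n₁ → Board n₂ → Set
  RookEquivalent B₁ B₂ = ∀ k → r k B₁ ≡ r k B₂

  ξ : ∀ {n} → Board n → Vec ℤ n
  ξ B = tabulate (λ i → + (m * toℕ i) ℤ.- + lookup (heights B) i)

  v : ∀ {n} → Board n → ℤ → ℕ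
  v B k = Vec.count (k ℤ.≟_) (ξ B)

  S : ℤ → Pred ℕ 0ℓ
  S M s = m ∣ s × + s ℤ.< M

  record Vertex {n} (B : Board n) : Set where
    field
      {columns}  : ℕ
      board      : Board columns
      singleton  : Singleton board
      equivalent : RookEquivalent board B

MovesCells : ∀ {N} → Vec ℕ N → Vec ℕ N → Set
MovesCells {N} C₁ C₂ =
  ∃[ i ] ∃[ j ] ∃[ k ]
    0 < k
    × lookup C₁ i ≡ lookup C₂ i + k
    × lookup C₁ j + k ≡ lookup C₂ j
    × (∀ (l : Fin N) → l ≢ i → l ≢ j → lookup C₁ l ≡ lookup C₂ l)

-- The number of columns N is immaterial: common zero columns on the left
-- never contribute to the difference.
Adjacent : ∀ {n₁ n₂} → Board n₁ → Board n₂ → Set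
Adjacent B₁ B₂ =
  ∃[ N ] Σ[ C₁ ∈ Vec ℕ N ] Σ[ C₂ ∈ Vec ℕ N ]
    heights B₁ ⊑₀ C₁ × heights B₂ ⊑₀ C₂ × MovesCells C₁ C₂

module _ (m : ℕ) .{{_ : NonZero m}} {n} (B : Board n) where

  -- Boards differing only by zero columns are the same vertex of the graph, so
  -- a walk may pass between such presentations freely.
  Step : Rel (Vertex m B) 0ℓ
  Step V W = Vertex.board V ≋ Vertex.board W ⊎ Adjacent (Vertex.board V) (Vertex.board W)

  GraphConnected : Set
  GraphConnected = ∀ (V W : Vertex m B) → Star Step V W

{-# OPTIONS --safe #-}

-- Adding a column of height b to the right of a singleton board turns the rook
-- numbers ρ into ρ_k + (b − (k − 1) m) ρ_{k−1}, because the k − 1 levels already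
-- occupied are full in the new column. Written in the root z = m n − b these steps
-- commute, and Σ ρ_k x (x − m) ⋯ (x − (n − k − 1) m) = Π (x − z_j); hence two
-- singleton boards are equivalent iff their root vectors are rearrangements of each
-- other. The vectors that occur start with 0 and each entry is at most the least
-- multiple of m above its predecessor; an edge of the graph exchanges two entries.
--
-- If the condition holds, let i be the least redundant entry (repeated, or not a
-- multiple of m). A last entry e > i can be exchanged with an earlier smaller one:
-- with s the largest multiple of m below e, two entries lie in [s, e), so some entry
-- below e directly follows an entry ≥ s. Eventually i is last, and one continues with
-- the other entries until only 0, m, 2m, … are left. If instead s > i occurs once and
-- s < M, everything before s is smaller than s and nothing after it can climb past s,
-- so no exchange moves s; but i can be placed before or after s.
module Submission where

open import Defs
open import Algebra.Properties.AbelianGroup using (∙-cancelʳ)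
open import Data.Fin.Base as Fin using (Fin; toℕ; opposite; _↑ʳ_)
import Data.Fin.Properties as Fin
open import Data.Integer.Base as ℤ using (ℤ; +_; 0ℤ; 1ℤ) renaming (_≤_ to _≤ᶻ_)
import Data.Integer.Properties as ℤ
import Data.Integer.Tactic.RingSolver as ℤ-Solver
open import Data.List.Base using (List; []; _∷_; _++_; length; filter; map; concatMap; foldl; foldr; upTo; allFin; reverse; replicate; _ʳ++_)
import Data.List.Properties as List
open import Data.List.Membership.Propositional using (lose; find) renaming (_∈_ to _∈ˡ_)
open import Data.List.Membership.Propositional.Properties using (∈-upTo⁻; ∈-∃++; ∈-++⁺ˡ; ∈-++⁻; ∈-map⁺; ∈-map⁻)
open import Data.List.Relation.Binary.Permutation.Propositional using (_↭_; refl; prep; swap; trans; ↭-sym; ↭-reflexive)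
open import Data.List.Relation.Binary.Permutation.Propositional.Properties
  using (↭-length; shift; filter-↭; ++⁺ˡ; ∈-resp-↭; drop-∷; ↭-map-inv; ↭-reverse; map⁺; All-resp-↭)
open import Data.List.Relation.Unary.All as ListAll using ([]; _∷_)
import Data.List.Relation.Unary.All.Properties as ListAll
open import Data.List.Relation.Unary.AllPairs as AllPairs using (AllPairs; []; _∷_)
import Data.List.Relation.Unary.AllPairs.Properties as AllPairs
open import Data.List.Relation.Unary.Any as Any using (Any; here; there)
open import Data.List.Relation.Unary.Linked as ListLinked using ([]; [-]; _∷_)
open import Data.List.Relation.Unary.Linked.Properties using (Linked⇒AllPairs)
import Data.List.Sort as Sort
open import Data.Nat.Base
open import Data.Nat.Divisibility using (_∣_; _∣?_; divides; divides-refl; ∣m∣n⇒∣m+n)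
open import Data.Nat.DivMod
open import Data.Nat.Induction using (<-wellFounded)
open import Data.Nat.Properties using (_≟_; _≤?_; _<?_)
import Data.Nat.Properties as ℕ
import Data.Nat.Tactic.RingSolver as ℕ-Solver
open import Data.Product.Base using (_×_; _,_; proj₁; proj₂; ∃-syntax)
open import Data.Sum.Base as Sum using (_⊎_; inj₁; inj₂; [_,_]′)
open import Data.Vec.Base as Vec using (Vec; []; _∷_; lookup; fromList; toList; tabulate)
import Data.Vec.Properties as Vec
open import Data.Vec.Relation.Unary.All using (All; []; _∷_)
open import Data.Vec.Relation.Unary.Linked as VecLinked using ([]; [-]; _∷_)
import Data.Vec.Relation.Unary.Linked.Properties as VecLinked
open import Function.Base using (_∘_; flip)
open import Function.Bundles using (_⇔_; mk⇔)
open import Induction.WellFounded using (Acc; acc)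
open import Level using (0ℓ)
open import Relation.Binary.Construct.Closure.ReflexiveTransitive as Star using (Star; ε; _◅_; _◅◅_)
open import Relation.Binary.Construct.Flip.EqAndOrd using (decTotalOrder)
open import Relation.Binary.Core using (Rel)
open import Relation.Binary.Definitions using (tri<; tri≈; tri>)
open import Relation.Binary.PropositionalEquality as ≡
  using (_≡_; _≢_; _≗_; refl; cong; cong₂; sym; subst; module ≡-Reasoning)
open import Relation.Nullary.Decidable using (Dec; yes; no; _×-dec_; _⊎-dec_; ¬?)
open import Relation.Nullary.Negation using (¬_; contradiction)
open import Relation.Unary using (Pred; Decidable; _∈_)

-- Rook numbers column by column

-- Vertices come with different numbers of columns, and the root vector of a vertex may have
-- negative entries although that of `B` has none. So boards are compared only after padding to a
-- common width. Padding by p columns adds p m to all roots and supplies the new entries 0, m, ...,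
-- (p - 1) m; being distinct multiples of m below the others, they create no redundant entry, and
-- the condition on s is merely translated. Lists run from the last column to the first so that
-- padding becomes an append and a place counted from the right does not depend on the width; the
-- obstruction to connectedness is such a place.
--
-- The condition speaks of the least redundant entry only, but the induction discards that entry. It
-- is therefore carried as a statement about all redundant entries. Minimality has a second use:
-- after the least redundant entry has been put last, every valid arrangement of the rest can be
-- followed by it, so moves of the rest never have to be corrected.

reversedHeights : ∀ {n} → Board n → List ℕ
reversedHeights B = reverse (Vec.toList (heights B))

module _ {A B : Set} {P : Pred A 0ℓ} {Q : Pred B 0ℓ} (P? : Decidable P) (Q? : Decidable Q) where

  length-filter-map : (f : A → B) → (∀ x → P x → Q (f x)) → (∀ x → Q (f x) → P x) →
                      ∀ xs → length (filter Q? (map f xs)) ≡ length (filter P? xs)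
  length-filter-map f to from []       = refl
  length-filter-map f to from (x ∷ xs) with P? x | Q? (f x)
  ... | yes _ | yes _ = cong suc (length-filter-map f to from xs)
  ... | no  _ | no  _ = length-filter-map f to from xs
  ... | yes p | no ¬q = contradiction (to x p) ¬q
  ... | no ¬p | yes q = contradiction (from x q) ¬p

module _ {A : Set} {P Q : Pred A 0ℓ} (P? : Decidable P) (Q? : Decidable Q) where

  filter-⊆-filter : ∀ {xs} → ListAll.All (λ x → Q x → P x) xs → filter Q? (filter P? xs) ≡ filter Q? xs
  filter-⊆-filter []                   = refl
  filter-⊆-filter {x ∷ xs} (q⇒p ∷ rest) with P? x
  ... | yes _ with Q? x
  ...   | yes _ = cong (x ∷_) (filter-⊆-filter rest)
  ...   | no  _ = filter-⊆-filter rest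
  filter-⊆-filter {x ∷ xs} (q⇒p ∷ rest) | no ¬p =
    ≡.trans (filter-⊆-filter rest) (sym (List.filter-reject Q? (¬p ∘ q⇒p)))

  length-filter-complement : ∀ {xs} → ListAll.All (λ x → ¬ Q x → P x) xs → ListAll.All (λ x → P x → ¬ Q x) xs →
                             length (filter P? xs) + length (filter Q? xs) ≡ length xs
  length-filter-complement [] [] = refl
  length-filter-complement {x ∷ xs} (¬q⇒p ∷ as) (p⇒¬q ∷ bs) with P? x | Q? x
  ... | yes p | yes q = contradiction q (p⇒¬q p)
  ... | no ¬p | no ¬q = contradiction (¬q⇒p ¬q) ¬p
  ... | yes p | no ¬q = cong suc (length-filter-complement as bs)
  ... | no ¬p | yes q = ≡.trans (ℕ.+-suc _ _) (cong suc (length-filter-complement as bs))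

-- A list satisfying `P` contains no element outside `C`, so the half of `subsets` that contains
-- such an element contributes nothing. With `C` the cells not attacked by a given rook, this turns
-- a constraint on placements into a deletion of cells.
filter-subsets : ∀ {A : Set} {C : Pred A 0ℓ} {P P′ : Pred (List A) 0ℓ}
  (C? : Decidable C) (P? : Decidable P) (P′? : Decidable P′) →
  (∀ xs → P xs → ListAll.All C xs × P′ xs) → (∀ xs → ListAll.All C xs → P′ xs → P xs) →
  ∀ L → length (filter P? (subsets L)) ≡ length (filter P′? (subsets (filter C? L)))
filter-subsets C? P? P′? to from [] with P? [] | P′? []
... | yes p | yes p′ = refl
... | no ¬p | no ¬p′ = refl
... | yes p | no ¬p′ = contradiction (proj₂ (to [] p)) ¬p′
... | no ¬p | yes p′ = contradiction (from [] [] p′) ¬p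
filter-subsets C? P? P′? to from (x ∷ L)
  rewrite List.filter-++ P? (map (x ∷_) (subsets L)) (subsets L)
        | List.length-++ (filter P? (map (x ∷_) (subsets L))) {filter P? (subsets L)}
  with C? x
... | yes c
  rewrite List.filter-++ P′? (map (x ∷_) (subsets (filter C? L))) (subsets (filter C? L))
        | List.length-++ (filter P′? (map (x ∷_) (subsets (filter C? L)))) {filter P′? (subsets (filter C? L))}
        | length-filter-map (P? ∘ (x ∷_)) P? (x ∷_) (λ _ p → p) (λ _ p → p) (subsets L)
        | length-filter-map (P′? ∘ (x ∷_)) P′? (x ∷_) (λ _ p → p) (λ _ p → p) (subsets (filter C? L))
  = cong₂ _+_
      (filter-subsets C? (P? ∘ (x ∷_)) (P′? ∘ (x ∷_))
        (λ xs p → ListAll.tail (proj₁ (to _ p)) , proj₂ (to _ p)) (λ xs cs → from _ (c ∷ cs)) L)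
      (filter-subsets C? P? P′? to from L)
... | no ¬c
  rewrite List.filter-none P? (ListAll.map⁺ (ListAll.universal (λ xs p → ¬c (ListAll.head (proj₁ (to (x ∷ xs) p)))) (subsets L)))
  = filter-subsets C? P? P′? to from L

module _ (m : ℕ) .{{_ : NonZero m}} where

  placements : ∀ {n} → ℕ → List (Cell n) → ℕ
  placements k L = length (filter (isPlacement? m k) (subsets L))

  placements-zero : ∀ {n} (L : List (Cell n)) → placements 0 L ≡ 1
  placements-zero []      = refl
  placements-zero (x ∷ L)
    rewrite List.filter-++ (isPlacement? m 0) (map (x ∷_) (subsets L)) (subsets L)
          | List.filter-none (isPlacement? m 0) (ListAll.map⁺ {f = x ∷_} (ListAll.universal (λ _ → λ ()) (subsets L)))
    = placements-zero L

  -- Either x carries a rook and the others avoid what it attacks, or x stays empty. Arbitrary lists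
  -- of cells are allowed because these deletions do not leave a board.
  placements-suc : ∀ {n} k x (L : List (Cell n)) →
    placements (suc k) (x ∷ L) ≡ placements k (filter (nonAttacking? m x) L) + placements (suc k) L
  placements-suc k x L
    rewrite List.filter-++ (isPlacement? m (suc k)) (map (x ∷_) (subsets L)) (subsets L)
          | List.length-++ (filter (isPlacement? m (suc k)) (map (x ∷_) (subsets L))) {filter (isPlacement? m (suc k)) (subsets L)}
          | length-filter-map (isPlacement? m (suc k) ∘ (x ∷_)) (isPlacement? m (suc k)) (x ∷_) (λ _ p → p) (λ _ p → p) (subsets L)
    = cong (_+ placements (suc k) L)
        (filter-subsets (nonAttacking? m x) (isPlacement? m (suc k) ∘ (x ∷_)) (isPlacement? m k)
          (λ { xs (len , na ∷ nas) → na , ℕ.suc-injective len , nas })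
          (λ { xs na (len , nas) → cong suc len , na ∷ nas }) L)

  SameLevel : ∀ {n} → Cell n → Cell n → Set
  SameLevel x d = proj₂ x / m ≡ proj₂ d / m

  sameLevel? : ∀ {n} (x : Cell n) → Decidable (SameLevel x)
  sameLevel? x d = proj₂ x / m ≟ proj₂ d / m

  -- D stands for the cells of column j, and x for a cell of an earlier column.
  FullLevel : ∀ {n} → Fin n → List (Cell n) → Cell n → Set
  FullLevel j D x = proj₁ x ≢ j × length (filter (sameLevel? x) D) ≡ m

  InColumn : ∀ {n} → Fin n → List (Cell n) → Set
  InColumn j = ListAll.All ((_≡ j) ∘ proj₁)

  -- From another column, x attacks in column j just the cells of its own level, which is full
  -- there: exactly m cells.
  length-nonAttacking : ∀ {n} {j : Fin n} {D x} → InColumn j D → FullLevel j D x →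
    length (filter (nonAttacking? m x) D) + m ≡ length D
  length-nonAttacking {D = D} {x} inj (x≢j , full) =
    ≡.trans (cong (λ l → length (filter (nonAttacking? m x) D) + l) (sym full))
      (length-filter-complement {P = NonAttacking m x} {Q = SameLevel x} (nonAttacking? m x) (sameLevel? x)
        (ListAll.map (λ { refl ≢l → x≢j , ≢l }) inj) (ListAll.universal (λ _ → proj₂) D))

  -- A single column holds at most one rook, and `placements k []` is 1 for k = 0 and 0 otherwise.
  -- The product is the form that `placements-addColumn` takes for an empty left part.
  placements-column : ∀ {n} {j : Fin n} k D → InColumn j D →
    + placements (suc k) D ≡ (+ length D ℤ.- + (k * m)) ℤ.* + placements k ([] {A = Cell n})
  placements-column zero    []      _  = refl
  placements-column (suc k) []      _  = sym (ℤ.*-zeroʳ (+ 0 ℤ.- + (suc k * m)))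
  placements-column k       (x ∷ D) (refl ∷ inj) =
    ≡.trans (cong +_ (≡.trans (placements-suc k x D) (cong (λ E → placements k E + _)
             (List.filter-none (nonAttacking? m x) (ListAll.map (λ eq na → proj₁ na (sym eq)) inj)))))
    (step k (placements-column k D inj))
    where
    step : ∀ k → + placements (suc k) D ≡ (+ length D ℤ.- + (k * m)) ℤ.* + placements k [] →
           + (placements k [] + placements (suc k) D) ≡
           (+ suc (length D) ℤ.- + (k * m)) ℤ.* + placements k []
    step zero    ih = ≡.trans (cong (ℤ._+_ (+ 1)) ih) (lemma (+ length D))
      where
      lemma : ∀ d → + 1 ℤ.+ (d ℤ.- + 0) ℤ.* + 1 ≡ (+ 1 ℤ.+ d ℤ.- + 0) ℤ.* + 1
      lemma = ℤ-Solver.solve-∀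
    step (suc k) ih = ≡.trans ih (≡.trans (ℤ.*-zeroʳ (+ length D ℤ.- + (suc k * m))) (sym (ℤ.*-zeroʳ (+ suc (length D) ℤ.- + (suc k * m)))))

  -- Induction over the cells x of the earlier columns. A rook on x costs one rook and deletes m
  -- cells of `D`, so the number of cells minus k m is the same in both branches of
  -- `placements-suc`. Hence `D` has to be any remainder of a column in which the levels met by `L`
  -- are full.
  placements-addColumn : ∀ {n} {j : Fin n} k L D → InColumn j D → ListAll.All (FullLevel j D) L →
    + placements (suc k) (L ++ D) ≡
    + placements (suc k) L ℤ.+ (+ length D ℤ.- + (k * m)) ℤ.* + placements k L
  placements-addColumn {n} k [] D inj [] = ≡.trans (placements-column k D inj) (sym (ℤ.+-identityˡ _))
  placements-addColumn {n} k (x ∷ L) D inj (full ∷ fulls) = begin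
    + placements (suc k) (x ∷ L ++ D)
      ≡⟨ cong +_ (placements-suc k x (L ++ D)) ⟩
    + placements k (filter NA? (L ++ D)) ℤ.+ + placements (suc k) (L ++ D)
      ≡⟨ cong₂ ℤ._+_ (cong (λ E → + placements k E) (List.filter-++ NA? L D))
           (placements-addColumn k L D inj fulls) ⟩
    + placements k (Lₓ ++ Dₓ) ℤ.+ (+ placements (suc k) L ℤ.+ (d ℤ.- + (k * m)) ℤ.* + placements k L)
      ≡⟨ rest k ⟩
    + placements k Lₓ ℤ.+ + placements (suc k) L ℤ.+ (d ℤ.- + (k * m)) ℤ.* + placements k (x ∷ L)
      ≡⟨ cong (λ p → + p ℤ.+ (d ℤ.- + (k * m)) ℤ.* + placements k (x ∷ L)) (placements-suc k x L) ⟨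
    + placements (suc k) (x ∷ L) ℤ.+ (d ℤ.- + (k * m)) ℤ.* + placements k (x ∷ L) ∎
    where
    open ≡-Reasoning
    NA? = nonAttacking? m x
    d = + length D
    Lₓ = filter NA? L
    Dₓ = filter NA? D

    -- A surviving cell y lies in another level than x, so deleting the level of x from `D` leaves
    -- the level of y intact.
    fullsₓ : ListAll.All (FullLevel _ Dₓ) Lₓ
    fullsₓ = ListAll.map still-full (ListAll.zip (ListAll.all-filter NA? L , ListAll.filter⁺ NA? fulls))
      where
      still-full : ∀ {y} → NonAttacking m x y × FullLevel _ D y → FullLevel _ Dₓ y
      still-full {y} (na , y≢j , y-full) = y≢j ,
        ≡.trans (cong length (filter-⊆-filter {P = NonAttacking m x} {Q = SameLevel y} NA? (sameLevel? y)
                 (ListAll.map (λ { refl y≡d → proj₁ full , λ x≡d → proj₂ na (≡.trans x≡d (sym y≡d)) }) inj))) y-full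

    rest : ∀ k → + placements k (Lₓ ++ Dₓ) ℤ.+ (+ placements (suc k) L ℤ.+ (d ℤ.- + (k * m)) ℤ.* + placements k L)
         ≡ + placements k Lₓ ℤ.+ + placements (suc k) L ℤ.+ (d ℤ.- + (k * m)) ℤ.* + placements k (x ∷ L)
    rest zero
      rewrite placements-zero (Lₓ ++ Dₓ) | placements-zero Lₓ | placements-zero L | placements-zero (x ∷ L)
      = sym (ℤ.+-assoc (+ 1) (+ placements 1 L) ((d ℤ.- + 0) ℤ.* + 1))
    rest (suc k) = begin
      + placements (suc k) (Lₓ ++ Dₓ) ℤ.+ (c₂ ℤ.+ e ℤ.* c₁)
        ≡⟨ cong (ℤ._+ (c₂ ℤ.+ e ℤ.* c₁)) (placements-addColumn k Lₓ Dₓ (ListAll.filter⁺ NA? inj) fullsₓ) ⟩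
      cₓ₁ ℤ.+ (+ length Dₓ ℤ.- + (k * m)) ℤ.* cₓ ℤ.+ (c₂ ℤ.+ e ℤ.* c₁)
        ≡⟨ cong (λ f → cₓ₁ ℤ.+ f ℤ.* cₓ ℤ.+ (c₂ ℤ.+ e ℤ.* c₁)) shorter ⟩
      cₓ₁ ℤ.+ e ℤ.* cₓ ℤ.+ (c₂ ℤ.+ e ℤ.* c₁)
        ≡⟨ regroup cₓ₁ e cₓ c₂ c₁ ⟩
      cₓ₁ ℤ.+ c₂ ℤ.+ e ℤ.* (cₓ ℤ.+ c₁)
        ≡⟨ cong (λ p → cₓ₁ ℤ.+ c₂ ℤ.+ e ℤ.* + p) (placements-suc k x L) ⟨
      cₓ₁ ℤ.+ c₂ ℤ.+ e ℤ.* + placements (suc k) (x ∷ L) ∎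
      where
      e   = d ℤ.- + (suc k * m)
      c₁  = + placements (suc k) L
      c₂  = + placements (suc (suc k)) L
      cₓ  = + placements k Lₓ
      cₓ₁ = + placements (suc k) Lₓ
      regroup : ∀ a e b c d → a ℤ.+ e ℤ.* b ℤ.+ (c ℤ.+ e ℤ.* d) ≡ a ℤ.+ c ℤ.+ e ℤ.* (b ℤ.+ d)
      regroup = ℤ-Solver.solve-∀
      cancel : ∀ a m b → a ℤ.- b ≡ (a ℤ.+ m) ℤ.- (m ℤ.+ b)
      cancel = ℤ-Solver.solve-∀
      shorter : + length Dₓ ℤ.- + (k * m) ≡ e
      shorter = ≡.trans (cancel (+ length Dₓ) (+ m) (+ (k * m)))
        (cong (λ l → + l ℤ.- + (suc k * m)) (length-nonAttacking inj full))

  -- The board is increasing and singleton exactly when every level met by a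
  -- column is full in the next one.
  infix 4 _≼_
  _≼_ : ℕ → ℕ → Set
  a ≼ b = ∀ t → t * m < a → suc t * m ≤ b

  ≼-trans : ∀ {a b c} → a ≼ b → b ≼ c → a ≼ c
  ≼-trans a≼b b≼c t tm<a = b≼c t (ℕ.<-≤-trans (ℕ.m<n+m (t * m) (>-nonZero⁻¹ m)) (a≼b t tm<a))

  /-unique : ∀ {t r} → t * m ≤ r → r < suc t * m → r / m ≡ t
  /-unique {t} {r} tm≤r r<tm+m = ℕ.≤-antisym (s≤s⁻¹ (m<n*o⇒m/o<n r<tm+m))
    (subst (_≤ r / m) (m*n/n≡m t m) (/-monoˡ-≤ m tm≤r))

  levelCount : ℕ → ℕ → ℕ
  levelCount t b = length (filter (λ r → t ≟ r / m) (upTo b))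

  levelCount-suc : ∀ t b → levelCount t (suc b) ≡ levelCount t b + length (filter (λ r → t ≟ r / m) (b ∷ []))
  levelCount-suc t b = begin
    levelCount t (suc b)
      ≡⟨ cong (λ rs → length (filter (λ r → t ≟ r / m) rs)) (List.upTo-∷ʳ b) ⟨
    length (filter (λ r → t ≟ r / m) (upTo b ++ b ∷ []))
      ≡⟨ cong length (List.filter-++ (λ r → t ≟ r / m) (upTo b) (b ∷ [])) ⟩
    length (filter (λ r → t ≟ r / m) (upTo b) ++ filter (λ r → t ≟ r / m) (b ∷ []))
      ≡⟨ List.length-++ (filter (λ r → t ≟ r / m) (upTo b)) ⟩
    levelCount t b + length (filter (λ r → t ≟ r / m) (b ∷ [])) ∎
    where open ≡-Reasoning

  levelCount-below : ∀ t → levelCount t (t * m) ≡ 0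
  levelCount-below t = cong length (List.filter-none (λ r → t ≟ r / m)
    (ListAll.tabulate λ r∈ t≡ → ℕ.<-irrefl (sym t≡) (m<n*o⇒m/o<n (∈-upTo⁻ r∈))))

  levelCount-within : ∀ t j → j ≤ m → levelCount t (j + t * m) ≡ j
  levelCount-within t zero    _   = levelCount-below t
  levelCount-within t (suc j) j<m = begin
    levelCount t (suc (j + t * m))
      ≡⟨ levelCount-suc t (j + t * m) ⟩
    levelCount t (j + t * m) + length (filter (λ r → t ≟ r / m) (j + t * m ∷ []))
      ≡⟨ cong₂ _+_ (levelCount-within t j (ℕ.<⇒≤ j<m))
           (cong length (List.filter-accept (λ r → t ≟ r / m)
             (sym (/-unique (ℕ.m≤n+m _ j) (ℕ.+-monoˡ-< (t * m) j<m))))) ⟩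
    j + 1
      ≡⟨ ℕ.+-comm j 1 ⟩
    suc j ∎
    where open ≡-Reasoning

  levelCount-above : ∀ t c → levelCount t (c + suc t * m) ≡ m
  levelCount-above t zero    = levelCount-within t m ℕ.≤-refl
  levelCount-above t (suc c) = begin
    levelCount t (suc (c + suc t * m))
      ≡⟨ levelCount-suc t (c + suc t * m) ⟩
    levelCount t (c + suc t * m) + length (filter (λ r → t ≟ r / m) (c + suc t * m ∷ []))
      ≡⟨ cong₂ _+_ (levelCount-above t c) (cong length (List.filter-reject (λ r → t ≟ r / m) beyond)) ⟩
    m + 0
      ≡⟨ ℕ.+-identityʳ m ⟩
    m ∎
    where
    open ≡-Reasoning
    beyond : t ≢ (c + suc t * m) / m
    beyond eq = ℕ.<-irrefl eq (subst (_≤ (c + suc t * m) / m) (m*n/n≡m (suc t) m)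
                  (/-monoˡ-≤ m (ℕ.m≤n+m (suc t * m) c)))

  levelCount-full : ∀ t b → suc t * m ≤ b → levelCount t b ≡ m
  levelCount-full t b tm≤b = subst (λ c → levelCount t c ≡ m) (ℕ.m∸n+n≡m tm≤b) (levelCount-above t (b ∸ suc t * m))

  addColumn : ℤ → (ℕ → ℤ) → (ℕ → ℤ)
  addColumn b ρ zero    = ρ zero
  addColumn b ρ (suc k) = ρ (suc k) ℤ.+ (b ℤ.- + (k * m)) ℤ.* ρ k

  addColumn-cong : ∀ b {ρ ρ′} → ρ ≗ ρ′ → addColumn b ρ ≗ addColumn b ρ′
  addColumn-cong b eq zero    = eq zero
  addColumn-cong b eq (suc k) = cong₂ (λ x y → x ℤ.+ (b ℤ.- + (k * m)) ℤ.* y) (eq (suc k)) (eq k)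

  foldl-addColumn-cong : ∀ hs {ρ ρ′} → ρ ≗ ρ′ → foldl (λ ρ b → addColumn (+ b) ρ) ρ hs ≗ foldl (λ ρ b → addColumn (+ b) ρ) ρ′ hs
  foldl-addColumn-cong []       eq = eq
  foldl-addColumn-cong (b ∷ hs) eq = foldl-addColumn-cong hs (addColumn-cong (+ b) eq)

  column : ∀ {n} → (Fin n → ℕ) → Fin n → List (Cell n)
  column h i = map (i ,_) (upTo (h i))

  FullBelow : ∀ {n} → (Fin n → ℕ) → Cell n → Fin n → Set
  FullBelow h x i = proj₁ x ≢ i × suc (proj₂ x / m) * m ≤ h i

  -- `L` collects the columns already passed. Their levels must be full in every later column, not
  -- only in the next one; this is where transitivity of `_≼_` enters when the lemma is applied.
  placements-columns : ∀ {n} (h : Fin n → ℕ) is L →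
    ListAll.All (λ x → ListAll.All (FullBelow h x) is) L → AllPairs (λ i j → i ≢ j × h i ≼ h j) is →
    ∀ k → + placements k (L ++ concatMap (column h) is) ≡
          foldl (λ ρ b → addColumn (+ b) ρ) (λ l → + placements l L) (map h is) k
  placements-columns h []       L _     _            k = cong (λ E → + placements k E) (List.++-identityʳ L)
  placements-columns h (i ∷ is) L fulls (i≼ ∷ pairs) k = begin
    + placements k (L ++ column h i ++ concatMap (column h) is)
      ≡⟨ cong (λ E → + placements k E) (List.++-assoc L (column h i) _) ⟨
    + placements k ((L ++ column h i) ++ concatMap (column h) is)
      ≡⟨ placements-columns h is (L ++ column h i)
           (ListAll.++⁺ (ListAll.map ListAll.tail fulls) (ListAll.map⁺ (ListAll.tabulate λ {r} r∈ → ListAll.map (λ { (i≢j , q) → i≢j ,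
               q (r / m) (ℕ.≤-<-trans (m/n*n≤m r m) (∈-upTo⁻ r∈)) }) i≼)))
           pairs k ⟩
    foldl (λ ρ b → addColumn (+ b) ρ) (λ l → + placements l (L ++ column h i)) (map h is) k
      ≡⟨ foldl-addColumn-cong (map h is) add k ⟩
    foldl (λ ρ b → addColumn (+ b) ρ) (addColumn (+ h i) (λ l → + placements l L)) (map h is) k ∎
    where
    open ≡-Reasoning
    full : ∀ {x} → FullBelow h x i → FullLevel i (column h i) x
    full {x} (x≢i , le) = x≢i ,
      ≡.trans (length-filter-map (λ r → proj₂ x / m ≟ r / m) (sameLevel? x) (i ,_) (λ _ p → p) (λ _ p → p) (upTo (h i)))
        (levelCount-full (proj₂ x / m) (h i) le)
    add : ∀ l → + placements l (L ++ column h i) ≡ addColumn (+ h i) (λ l → + placements l L) l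
    add zero    = cong +_ (≡.trans (placements-zero (L ++ column h i)) (sym (placements-zero L)))
    add (suc l) = ≡.trans
      (placements-addColumn l L (column h i) (ListAll.map⁺ (ListAll.universal (λ _ → refl) (upTo (h i))))
        (ListAll.map (full ∘ ListAll.head) fulls))
      (cong (λ b → + placements (suc l) L ℤ.+ (+ b ℤ.- + (l * m)) ℤ.* + placements l L)
        (≡.trans (List.length-map (i ,_) (upTo (h i))) (List.length-upTo (h i))))

  δ : ℕ → ℤ
  δ zero    = ℤ.1ℤ
  δ (suc _) = 0ℤ

  -- The heights are listed from the last column to the first.
  rooks : List ℕ → ℕ → ℤ
  rooks = foldr (addColumn ∘ +_) δ

  -- If a is a multiple of m, every level met by a lies entirely under a, hence under b. Otherwise
  -- the top level met by a is partial, but b reaches the next multiple of m above a.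
  singleton⇒≼ : ∀ {a b} → a ≤ b → (a ∸ a / m * m ≢ 0 → a / m * m < b / m * m) → a ≼ b
  singleton⇒≼ {a} {b} a≤b sing t tm<a with a ∸ a / m * m ≟ 0
  ... | yes eq = ℕ.≤-trans (ℕ.*-monoˡ-≤ m (ℕ.*-cancelʳ-< m t (a / m) (ℕ.<-≤-trans tm<a (ℕ.m∸n≡0⇒m≤n eq))))
                   (ℕ.≤-trans (m/n*n≤m a m) a≤b)
  ... | no ≢0 = ℕ.≤-trans (ℕ.*-monoˡ-≤ m (ℕ.≤-<-trans
                   (subst (_≤ a / m) (m*n/n≡m t m) (/-monoˡ-≤ m (ℕ.<⇒≤ tm<a))) (ℕ.*-cancelʳ-< m (a / m) (b / m) (sing ≢0))))
                   (m/n*n≤m b m)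

  n<[1+n/m]*m : ∀ a → a < suc (a / m) * m
  n<[1+n/m]*m a = subst (_< suc (a / m) * m) (sym (m≡m%n+[m/n]*n a m)) (ℕ.+-monoˡ-< (a / m * m) (m%n<n a m))

  ≼⇒≤ : ∀ {a b} → a ≼ b → a ≤ b
  ≼⇒≤ {zero}  _   = z≤n
  ≼⇒≤ {suc a} a≼b = ℕ.≤-trans (n<[1+n/m]*m a) (a≼b (a / m) (s≤s (m/n*n≤m a m)))

  ≼⇒singleton : ∀ {a b} → a ≼ b → a ∸ a / m * m ≢ 0 → a / m * m < b / m * m
  ≼⇒singleton {a} {b} a≼b ≢0 = ℕ.*-monoˡ-< m
    (subst (_≤ b / m) (m*n/n≡m (suc (a / m)) m)
      (/-monoˡ-≤ m (a≼b (a / m) (ℕ.≰⇒> λ le → ≢0 (ℕ.m≤n⇒m∸n≡0 le)))))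

  board-≼ : ∀ {n} (B : Board n) → Singleton m B → VecLinked.Linked _≼_ (heights B)
  board-≼ B sing = VecLinked.zipWith (λ { (le , s) → singleton⇒≼ le s }) (increasing B , sing)

  toList-tabulate : ∀ {n} (xs : Vec ℕ n) → Vec.toList xs ≡ map (Vec.lookup xs) (allFin n)
  toList-tabulate []       = refl
  toList-tabulate (x ∷ xs) = cong (x ∷_) (≡.trans (toList-tabulate xs)
    (≡.trans (List.map-tabulate (λ i → i) (Vec.lookup xs)) (sym (List.map-tabulate Fin.suc (Vec.lookup (x ∷ xs))))))


  rooks-board : ∀ {n} (B : Board n) → Singleton m B → ∀ k → + r m k B ≡ rooks (reversedHeights B) k
  rooks-board {n} B sing k = begin
    + r m k B
      ≡⟨ placements-columns (Vec.lookup (heights B)) (allFin n) [] []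
           (AllPairs.tabulate⁺-< λ i<j → Fin.<⇒≢ i<j , VecLinked.lookup⁺ (λ {a} {b} {c} → ≼-trans {a} {b} {c}) (board-≼ B sing) i<j) k ⟩
    foldl (λ ρ b → addColumn (+ b) ρ) (λ l → + placements {n} l []) (map (Vec.lookup (heights B)) (allFin n)) k
      ≡⟨ cong (λ hs → foldl (λ ρ b → addColumn (+ b) ρ) (λ l → + placements {n} l []) hs k) (toList-tabulate (heights B)) ⟨
    foldl (λ ρ b → addColumn (+ b) ρ) (λ l → + placements {n} l []) (Vec.toList (heights B)) k
      ≡⟨ foldl-addColumn-cong (Vec.toList (heights B)) (λ { zero → refl ; (suc _) → refl }) k ⟩
    foldl (λ ρ b → addColumn (+ b) ρ) δ (Vec.toList (heights B)) k
      ≡⟨ cong (λ f → f k) (List.reverse-foldr (addColumn ∘ +_) δ (Vec.toList (heights B))) ⟨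
    rooks (reversedHeights B) k ∎
    where open ≡-Reasoning

-- Rook numbers in terms of roots

module _ (m : ℕ) .{{_ : NonZero m}} where

  -- Here z stands for a column of height m n - z, n being the number of columns to its left. This
  -- height may be negative: the list is going to be permuted, and an arbitrary order of the roots
  -- need not come from a board. Hence the integer argument of `addColumn`.
  rootRooks : List ℤ → ℕ → ℤ
  rootRooks []       = δ m
  rootRooks (z ∷ zs) = addColumn m (+ (m * length zs) ℤ.- z) (rootRooks zs)

  +m*suc : ∀ n → + (m * suc n) ≡ + m ℤ.+ + (m * n)
  +m*suc n = cong +_ (ℕ.*-suc m n)

  rootRooks-vanish : ∀ zs k → length zs < k → rootRooks zs k ≡ 0ℤ
  rootRooks-vanish []       (suc k) _ = refl
  rootRooks-vanish (z ∷ zs) (suc k) (s≤s lt)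
    rewrite rootRooks-vanish zs k lt | rootRooks-vanish zs (suc k) (ℕ.m<n⇒m<1+n lt) =
    ≡.trans (ℤ.+-identityˡ (b ℤ.* 0ℤ)) (ℤ.*-zeroʳ b)
    where b = + (m * length zs) ℤ.- z ℤ.- + (k * m)

  -- With l = m n and q = k m, the coefficient of ρ_k is (l - x - q)(l - y - q): the m gained by
  -- standing one column further right pays for the one rook more. The coefficient of the next value
  -- of ρ depends on x + y only.
  addColumn-comm : ∀ n x y ρ →
    addColumn m (+ (m * suc n) ℤ.- x) (addColumn m (+ (m * n) ℤ.- y) ρ) ≗
    addColumn m (+ (m * suc n) ℤ.- y) (addColumn m (+ (m * n) ℤ.- x) ρ)
  addColumn-comm n x y ρ zero = refl
  addColumn-comm n x y ρ (suc zero) rewrite +m*suc n = lemma (+ m) (+ (m * n)) x y (ρ 0) (ρ 1)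
    where
    lemma : ∀ m l x y a b → (b ℤ.+ (l ℤ.- y ℤ.- 0ℤ) ℤ.* a) ℤ.+ (m ℤ.+ l ℤ.- x ℤ.- 0ℤ) ℤ.* a ≡
                            (b ℤ.+ (l ℤ.- x ℤ.- 0ℤ) ℤ.* a) ℤ.+ (m ℤ.+ l ℤ.- y ℤ.- 0ℤ) ℤ.* a
    lemma = ℤ-Solver.solve-∀
  addColumn-comm n x y ρ (suc (suc k)) rewrite +m*suc n =
    lemma (+ m) (+ (m * n)) (+ (k * m)) x y (ρ k) (ρ (suc k)) (ρ (suc (suc k)))
    where
    lemma : ∀ m l q x y a b c →
      c ℤ.+ (l ℤ.- y ℤ.- (m ℤ.+ q)) ℤ.* b ℤ.+ (m ℤ.+ l ℤ.- x ℤ.- (m ℤ.+ q)) ℤ.* (b ℤ.+ (l ℤ.- y ℤ.- q) ℤ.* a) ≡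
      c ℤ.+ (l ℤ.- x ℤ.- (m ℤ.+ q)) ℤ.* b ℤ.+ (m ℤ.+ l ℤ.- y ℤ.- (m ℤ.+ q)) ℤ.* (b ℤ.+ (l ℤ.- x ℤ.- q) ℤ.* a)
    lemma = ℤ-Solver.solve-∀

  rootRooks-↭ : ∀ {zs ws} → zs ↭ ws → rootRooks zs ≗ rootRooks ws
  rootRooks-↭ refl k = refl
  rootRooks-↭ (prep {xs} {ys} z p) k rewrite ↭-length p = addColumn-cong m (+ (m * length ys) ℤ.- z) (rootRooks-↭ p) k
  rootRooks-↭ (swap {xs} {ys} x y p) k rewrite ↭-length p = ≡.trans
    (addColumn-cong m _ (addColumn-cong m (+ (m * length ys) ℤ.- y) (rootRooks-↭ p)) k)
    (addColumn-comm (length ys) x y (rootRooks ys) k)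
  rootRooks-↭ (trans p q) k = ≡.trans (rootRooks-↭ p k) (rootRooks-↭ q k)

  falling : ℕ → ℤ → ℤ
  falling zero    x = 1ℤ
  falling (suc n) x = falling n x ℤ.* (x ℤ.- + (m * n))

  -- Σ_{k ≤ n} ρ_k x (x − m) ⋯ (x − (n − k − 1) m)
  rookPolynomial : ℕ → (ℕ → ℤ) → ℤ → ℤ
  rookPolynomial zero    ρ x = ρ 0
  rookPolynomial (suc n) ρ x = ρ 0 ℤ.* falling (suc n) x ℤ.+ rookPolynomial n (ρ ∘ suc) x

  rookPolynomial-cong : ∀ n {ρ ρ′} x → ρ ≗ ρ′ → rookPolynomial n ρ x ≡ rookPolynomial n ρ′ x
  rookPolynomial-cong zero    x eq = eq 0
  rookPolynomial-cong (suc n) x eq = cong₂ (λ a b → a ℤ.* falling (suc n) x ℤ.+ b) (eq 0) (rookPolynomial-cong n x (eq ∘ suc))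

  -- Split x - z as (x - (n - k) m) + ((n - k) m - z) in the k-th term: the first summand lengthens
  -- the falling product by a factor, the second is the coefficient in `addColumn`. The assumption
  -- on ρ says that truncation at n loses nothing.
  rookPolynomial-addColumn : ∀ n z ρ x → ρ (suc n) ≡ 0ℤ →
    rookPolynomial (suc n) (addColumn m (+ (m * n) ℤ.- z) ρ) x ≡ (x ℤ.- z) ℤ.* rookPolynomial n ρ x
  rookPolynomial-addColumn zero z ρ x eq rewrite eq | ℕ.*-zeroʳ m = lemma x z (ρ 0)
    where
    lemma : ∀ x z a → a ℤ.* (1ℤ ℤ.* (x ℤ.- 0ℤ)) ℤ.+ (0ℤ ℤ.+ (0ℤ ℤ.- z ℤ.- 0ℤ) ℤ.* a) ≡ (x ℤ.- z) ℤ.* a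
    lemma = ℤ-Solver.solve-∀
  rookPolynomial-addColumn (suc n) z ρ x eq = begin
    ρ 0 ℤ.* (f ℤ.* (x ℤ.- c)) ℤ.+ ((ρ 1 ℤ.+ (c ℤ.- z ℤ.- 0ℤ) ℤ.* ρ 0) ℤ.* f ℤ.+
      rookPolynomial n (addColumn m (c ℤ.- z) ρ ∘ suc ∘ suc) x)
      ≡⟨ cong (λ p → ρ 0 ℤ.* (f ℤ.* (x ℤ.- c)) ℤ.+ ((ρ 1 ℤ.+ (c ℤ.- z ℤ.- 0ℤ) ℤ.* ρ 0) ℤ.* f ℤ.+ p))
           (rookPolynomial-cong n x shifted) ⟩
    ρ 0 ℤ.* (f ℤ.* (x ℤ.- c)) ℤ.+ ((ρ 1 ℤ.+ (c ℤ.- z ℤ.- 0ℤ) ℤ.* ρ 0) ℤ.* f ℤ.+ rest)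
      ≡⟨ regroup (ρ 0) (ρ 1) f x c z rest ⟩
    (x ℤ.- z) ℤ.* (ρ 0 ℤ.* f) ℤ.+ (ρ 1 ℤ.* f ℤ.+ rest)
      ≡⟨ cong (λ p → (x ℤ.- z) ℤ.* (ρ 0 ℤ.* f) ℤ.+ p) (rookPolynomial-addColumn n z (ρ ∘ suc) x eq) ⟩
    (x ℤ.- z) ℤ.* (ρ 0 ℤ.* f) ℤ.+ (x ℤ.- z) ℤ.* rookPolynomial n (ρ ∘ suc) x
      ≡⟨ ℤ.*-distribˡ-+ (x ℤ.- z) (ρ 0 ℤ.* f) _ ⟨
    (x ℤ.- z) ℤ.* (ρ 0 ℤ.* f ℤ.+ rookPolynomial n (ρ ∘ suc) x) ∎
    where
    open ≡-Reasoning
    f = falling (suc n) x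
    c = + (m * suc n)
    rest = rookPolynomial n (addColumn m (+ (m * n) ℤ.- z) (ρ ∘ suc) ∘ suc) x
    -- One index more and m more height leave the coefficient unchanged, so the tail is an instance
    -- of the same lemma for n.
    shifted : addColumn m (c ℤ.- z) ρ ∘ suc ∘ suc ≗ addColumn m (+ (m * n) ℤ.- z) (ρ ∘ suc) ∘ suc
    shifted k = cong (λ d → ρ (suc (suc k)) ℤ.+ d ℤ.* ρ (suc k))
      (≡.trans (cong (λ c → c ℤ.- z ℤ.- + (suc k * m)) (+m*suc n)) (lemma (+ m) (+ (m * n)) z (+ (k * m))))
      where
      lemma : ∀ m l z q → m ℤ.+ l ℤ.- z ℤ.- (m ℤ.+ q) ≡ l ℤ.- z ℤ.- q
      lemma = ℤ-Solver.solve-∀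
    regroup : ∀ a b f x c z r → a ℤ.* (f ℤ.* (x ℤ.- c)) ℤ.+ ((b ℤ.+ (c ℤ.- z ℤ.- 0ℤ) ℤ.* a) ℤ.* f ℤ.+ r) ≡
                                (x ℤ.- z) ℤ.* (a ℤ.* f) ℤ.+ (b ℤ.* f ℤ.+ r)
    regroup = ℤ-Solver.solve-∀

  factorization : ∀ z zs x → rookPolynomial (length (z ∷ zs)) (rootRooks (z ∷ zs)) x ≡
                             (x ℤ.- z) ℤ.* rookPolynomial (length zs) (rootRooks zs) x
  factorization z zs x = rookPolynomial-addColumn (length zs) z (rootRooks zs) x (rootRooks-vanish zs _ ℕ.≤-refl)

  -- By `factorization` the polynomial is the product of the x - z, and ℤ has no zero divisors; for
  -- the empty list it is the constant 1.
  root∈ : ∀ zs x → rookPolynomial (length zs) (rootRooks zs) x ≡ 0ℤ → x ∈ˡ zs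
  root∈ []       x ()
  root∈ (z ∷ zs) x eq with ℤ.i*j≡0⇒i≡0∨j≡0 (x ℤ.- z) (≡.trans (sym (factorization z zs x)) eq)
  ... | inj₁ x-z≡0 = here (ℤ.i-j≡0⇒i≡j x z x-z≡0)
  ... | inj₂ p≡0   = there (root∈ zs x p≡0)

  -- The transformation is unitriangular: each new value is the old one plus a multiple of its
  -- predecessor.
  addColumn-injective : ∀ b {ρ ρ′} → addColumn m b ρ ≗ addColumn m b ρ′ → ρ ≗ ρ′
  addColumn-injective b eq zero    = eq zero
  addColumn-injective b {ρ} {ρ′} eq (suc k) = ∙-cancelʳ ℤ.+-0-abelianGroup _ _ _ (≡.trans (eq (suc k))
    (cong (λ a → ρ′ (suc k) ℤ.+ (b ℤ.- + (k * m)) ℤ.* a) (sym (addColumn-injective b eq k))))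

  -- The head z is a zero of its own polynomial, hence of that of `ws`, so it occurs in `ws`. Once
  -- it is permuted to the front there, its column can be cancelled on both sides. Equal lengths are
  -- essential: the width enters both the polynomial and the heights.
  rootRooks-injective : ∀ zs ws → length zs ≡ length ws → rootRooks zs ≗ rootRooks ws → zs ↭ ws
  rootRooks-injective []       []       _   _  = refl
  rootRooks-injective (z ∷ zs) ws len eq
    with us , vs , refl ← ∈-∃++ (root∈ ws z (≡.trans
      (≡.trans (cong (λ n → rookPolynomial n (rootRooks ws) z) (sym len))
        (≡.trans (rookPolynomial-cong (length (z ∷ zs)) z (sym ∘ eq)) (factorization z zs z)))
      (cong (ℤ._* rookPolynomial (length zs) (rootRooks zs) z) (ℤ.+-inverseʳ z))))
    = trans (prep z (rootRooks-injective zs (us ++ vs) len′ (addColumn-injective (+ (m * length zs) ℤ.- z) eq′)))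
            (↭-sym (shift z us vs))
    where
    len′ : length zs ≡ length (us ++ vs)
    len′ = ℕ.suc-injective (≡.trans len (↭-length (shift z us vs)))
    eq′ : addColumn m (+ (m * length zs) ℤ.- z) (rootRooks zs) ≗ addColumn m (+ (m * length zs) ℤ.- z) (rootRooks (us ++ vs))
    eq′ k = ≡.trans (eq k) (≡.trans (rootRooks-↭ (shift z us vs) k)
      (cong (λ n → addColumn m (+ (m * n) ℤ.- z) (rootRooks (us ++ vs)) k) (sym len′)))

  roots : List ℕ → List ℤ
  roots []       = []
  roots (h ∷ hs) = (+ (m * length hs) ℤ.- + h) ∷ roots hs

  length-roots : ∀ hs → length (roots hs) ≡ length hs
  length-roots []       = refl
  length-roots (h ∷ hs) = cong suc (length-roots hs)

  rooks-roots : ∀ hs → rooks m hs ≗ rootRooks (roots hs)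
  rooks-roots []       k = refl
  rooks-roots (h ∷ hs) k rewrite length-roots hs = ≡.trans
    (addColumn-cong m (+ h) (rooks-roots hs) k)
    (cong (λ b → addColumn m b (rootRooks (roots hs)) k) (lemma (+ (m * length hs)) (+ h)))
    where
    lemma : ∀ c h → h ≡ c ℤ.- (c ℤ.- h)
    lemma = ℤ-Solver.solve-∀

-- Arrangements of a root vector

occurrences : ℕ → List ℕ → ℕ
occurrences x l = length (filter (x ≟_) l)

occurrences-↭ : ∀ x {l l′} → l ↭ l′ → occurrences x l ≡ occurrences x l′
occurrences-↭ x p = ↭-length (filter-↭ (x ≟_) p)

occurrences-here : ∀ x l → occurrences x (x ∷ l) ≡ suc (occurrences x l)
occurrences-here x l = cong length (List.filter-accept (x ≟_) refl)

occurrences-there : ∀ {x y} l → x ≢ y → occurrences x (y ∷ l) ≡ occurrences x l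
occurrences-there {x} l x≢y = cong length (List.filter-reject (x ≟_) x≢y)

∈⇒occurrences : ∀ {x l} → x ∈ˡ l → 0 < occurrences x l
∈⇒occurrences {x} x∈l = List.filter-some (x ≟_) x∈l

occurrences⇒∈ : ∀ {x} l → 0 < occurrences x l → x ∈ˡ l
occurrences⇒∈ {x} (y ∷ l) 0<n with x ≟ y
... | yes x≡y = here x≡y
... | no  x≢y = there (occurrences⇒∈ l (subst (0 <_) (occurrences-there l x≢y) 0<n))

∈-tail : ∀ {x y : ℕ} {l} → x ∈ˡ y ∷ l → x ≢ y → x ∈ˡ l
∈-tail (here x≡y)  x≢y = contradiction x≡y x≢y
∈-tail (there x∈l) _   = x∈l

-- Lists run from the last column to the first, so b is later than y and c earlier.
Before : (ℕ → Set) → (ℕ → Set) → List ℕ → Set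
Before P Q l = ∃[ b ] ∃[ y ] ∃[ c ] l ≡ b ++ y ∷ c × P y × Any Q c

before-∷ : ∀ {P Q : ℕ → Set} {l} x → Before P Q l → Before P Q (x ∷ l)
before-∷ x (b , y , c , eq , py , qc) = x ∷ b , y , c , cong (x ∷_) eq , py , qc

distinct-before : ∀ {P : ℕ → Set} {x y l} → x ∈ˡ l → y ∈ˡ l → x ≢ y → P x → P y → Before P P l
distinct-before (here refl) (here refl) x≢y _  _  = contradiction refl x≢y
distinct-before (here refl) (there y∈)  _   px py = [] , _ , _ , refl , px , lose y∈ py
distinct-before (there x∈)  (here refl) _   px py = [] , _ , _ , refl , py , lose x∈ px
distinct-before (there x∈)  (there y∈)  x≢y px py = before-∷ _ (distinct-before x∈ y∈ x≢y px py)

repeated-before : ∀ {P : ℕ → Set} {x} l → 1 < occurrences x l → P x → Before P P l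
repeated-before {x = x} (y ∷ l) 1<n px with x ≟ y
... | yes refl = [] , _ , _ , refl , px , lose (occurrences⇒∈ l (s≤s⁻¹ (subst (1 <_) (occurrences-here x l) 1<n))) px
... | no  x≢y  = before-∷ y (repeated-before l (subst (1 <_) (occurrences-there l x≢y) 1<n) px)

-- The larger entry e leaves the later column for the earlier one; `Move` allows both directions.
data Swap : List ℕ → List ℕ → Set where
  swap : ∀ a b c {e x} → x < e → Swap (a ++ e ∷ b ++ x ∷ c) (a ++ x ∷ b ++ e ∷ c)

swap-∷ : ∀ y {l l′} → Swap l l′ → Swap (y ∷ l) (y ∷ l′)
swap-∷ y (swap a b c x<e) = swap (y ∷ a) b c x<e

swap-↭ : ∀ {l l′} → Swap l l′ → l ↭ l′
swap-↭ (swap a b c {e} {x} _) = ++⁺ˡ a (trans (prep e (shift x b c)) (trans (swap e x refl) (prep x (↭-sym (shift e b c)))))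

module _ (m : ℕ) .{{_ : NonZero m}} where

  -- e may follow a in a root vector: e is at most the least multiple of m above a.
  Next : ℕ → ℕ → Set
  Next a e = ∀ t → t * m < e → t * m ≤ a

  -- The root vectors of singleton boards, listed from the last column to the first.
  data Valid : List ℕ → Set where
    []    : Valid []
    first : Valid (0 ∷ [])
    _∷_   : ∀ {e a l} → Next a e → Valid (a ∷ l) → Valid (e ∷ a ∷ l)

  valid-tail : ∀ {e l} → Valid (e ∷ l) → Valid l
  valid-tail first     = []
  valid-tail (_ ∷ val) = val

  -- From the left, the entries start at 0 and can never step over a multiple of m, so all multiples
  -- up to x are met.
  closed : ∀ {l x} → Valid l → x ∈ˡ l → ∀ t → t * m ≤ x → t * m ∈ˡ l
  closed first (here refl) t tm≤0 = here (ℕ.n≤0⇒n≡0 tm≤0)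
  closed {e ∷ a ∷ _} (nxt ∷ val) (here refl) t tm≤e with t * m ≟ e
  ... | yes tm≡e = here tm≡e
  ... | no  tm≢e = there (closed val (here refl) t (nxt t (ℕ.≤∧≢⇒< tm≤e tm≢e)))
  closed (_ ∷ val) (there x∈) t tm≤x = there (closed val x∈ t tm≤x)

  -- Such an entry can be taken out of a valid list without losing any multiple of m, so what
  -- remains can still be arranged validly.
  Redundant : ℕ → List ℕ → Set
  Redundant x l = 1 < occurrences x l ⊎ (occurrences x l ≡ 1 × ¬ (m ∣ x))

  redundant? : ∀ x l → Dec (Redundant x l)
  redundant? x l = (1 <? occurrences x l) ⊎-dec ((occurrences x l ≟ 1) ×-dec ¬? (m ∣? x))

  redundant-↭ : ∀ {x l l′} → l ↭ l′ → Redundant x l → Redundant x l′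
  redundant-↭ {x} p red rewrite occurrences-↭ x p = red

  redundant-∈ : ∀ {x l} → Redundant x l → x ∈ˡ l
  redundant-∈ {l = l} (inj₁ 1<n)       = occurrences⇒∈ l (ℕ.<⇒≤ 1<n)
  redundant-∈ {l = l} (inj₂ (n≡1 , _)) = occurrences⇒∈ l (ℕ.≤-reflexive (sym n≡1))

  ∣-redundant : ∀ {x l} → m ∣ x → Redundant x l → 1 < occurrences x l
  ∣-redundant m∣x (inj₁ 1<n)       = 1<n
  ∣-redundant m∣x (inj₂ (_ , m∤x)) = contradiction m∣x m∤x

  ∤-redundant : ∀ {x l} → x ∈ˡ l → ¬ (m ∣ x) → Redundant x l
  ∤-redundant {x} {l} x∈l m∤x with ℕ.m≤n⇒m<n∨m≡n (∈⇒occurrences x∈l)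
  ... | inj₁ 1<n = inj₁ 1<n
  ... | inj₂ 1≡n = inj₂ (sym 1≡n , m∤x)

  repeated-redundant : ∀ {x l} → x ∈ˡ l → Redundant x (x ∷ l)
  repeated-redundant {x} {l} x∈l = inj₁ (subst (1 <_) (sym (occurrences-here x l)) (s≤s (∈⇒occurrences x∈l)))

  redundant-∷ : ∀ {x l} y → Redundant x l → Redundant x (y ∷ l)
  redundant-∷ {x} {l} y red with x ≟ y
  redundant-∷ {x} {l} y red        | yes refl = repeated-redundant (redundant-∈ red)
  redundant-∷ {x} {l} y (inj₁ 1<n) | no x≢y = inj₁ (subst (1 <_) (sym (occurrences-there l x≢y)) 1<n)
  redundant-∷ {x} {l} y (inj₂ (n≡1 , m∤x)) | no x≢y = inj₂ (≡.trans (occurrences-there l x≢y) n≡1 , m∤x)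

  -- A multiple e of m has been passed on the way up to x > e.
  earlier-redundant : ∀ {e l x} → Valid (e ∷ l) → x ∈ˡ l → e < x → Redundant e (e ∷ l)
  earlier-redundant {e} {l} val x∈l e<x with m ∣? e
  ... | no m∤e = ∤-redundant (here refl) m∤e
  ... | yes (divides t refl) = repeated-redundant (closed (valid-tail val) x∈l t (ℕ.<⇒≤ e<x))

  Minimal : ℕ → List ℕ → Set
  Minimal i l = Redundant i l × (∀ x → Redundant x l → i ≤ x)

  minimal-↭ : ∀ {i l l′} → l ↭ l′ → Minimal i l → Minimal i l′
  minimal-↭ p (red , min) = redundant-↭ p red , λ x red-x → min x (redundant-↭ (↭-sym p) red-x)

  minimal-redundant : ∀ l → (∀ x → ¬ Redundant x l) ⊎ (∃[ i ] Minimal i l)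
  minimal-redundant l with Any.any? (λ x → redundant? x l) l
  ... | no none = inj₁ λ x red → none (lose (redundant-∈ red) red)
  ... | yes some with x , _ , red ← find some = inj₂ (descend x (<-wellFounded x) red)
    where
    descend : ∀ x → Acc _<_ x → Redundant x l → ∃[ i ] Minimal i l
    descend x (acc rs) red with Any.any? (λ y → redundant? y l ×-dec (y <? x)) l
    ... | yes some with y , _ , red-y , y<x ← find some = descend y (rs y<x) red-y
    ... | no none = x , red , λ y red-y → ℕ.≮⇒≥ λ y<x → none (lose (redundant-∈ red-y) (red-y , y<x))

  -- Besides the raised entry itself, only its successor is affected, and a larger predecessor
  -- permits more.
  raise-valid : ∀ b {x e c} → Valid (b ++ x ∷ c) → x ≤ e → Valid (e ∷ c) → Valid (b ++ e ∷ c)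
  raise-valid []          _           _   val-e = val-e
  raise-valid (y ∷ [])    (nxt ∷ _)   x≤e val-e = (λ t lt → ℕ.≤-trans (nxt t lt) x≤e) ∷ val-e
  raise-valid (y ∷ z ∷ b) (nxt ∷ val) x≤e val-e = nxt ∷ raise-valid (z ∷ b) val x≤e val-e

  -- Raising x to e is legal because e may follow a. At the right end nothing follows e, and
  -- lowering a last entry only weakens its condition.
  exchange-valid : ∀ {e x a} b c → Valid (e ∷ b ++ x ∷ a ∷ c) → x < e → Next a e →
                   Valid (x ∷ b ++ e ∷ a ∷ c)
  exchange-valid {e} {x} {a} b c val x<e nxt = go b val (raise-valid b (valid-tail val) (ℕ.<⇒≤ x<e) (nxt ∷ valid-suffix b (valid-tail val)))
    where
    valid-suffix : ∀ b → Valid (b ++ x ∷ a ∷ c) → Valid (a ∷ c)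
    valid-suffix []      v = valid-tail v
    valid-suffix (_ ∷ b) v = valid-suffix b (valid-tail v)
    go : ∀ b → Valid (e ∷ b ++ x ∷ a ∷ c) → Valid (b ++ e ∷ a ∷ c) → Valid (x ∷ b ++ e ∷ a ∷ c)
    go []      _          v = (λ t lt → ℕ.<⇒≤ (ℕ.<-trans lt x<e)) ∷ v
    go (y ∷ b) (nxt′ ∷ _) v = (λ t lt → nxt′ t (ℕ.<-trans lt x<e)) ∷ v

  -- The target of an exchange with the last entry e: the place of x, whose left neighbour a is high
  -- enough for e once s is the largest multiple of m below e.
  Ascent : ℕ → ℕ → List ℕ → Set
  Ascent s e l = ∃[ b ] ∃[ x ] ∃[ a ] ∃[ c ] l ≡ b ++ x ∷ a ∷ c × x < e × s ≤ a

  -- Walking left from y, stop at the first entry a ≥ s. What stands right of it is y or an entry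
  -- passed over for being below s ≤ e, so it is below e.
  before⇒ascent : ∀ {s e l} → s ≤ e → Before (_< e) (s ≤_) l → Ascent s e l
  before⇒ascent {s} {e} s≤e (b , y , c , refl , y<e , some) = go b y c y<e some
    where
    go : ∀ b y c → y < e → Any (s ≤_) c → Ascent s e (b ++ y ∷ c)
    go b y (a ∷ c) y<e some with s ≤? a
    ... | yes s≤a = b , y , a , c , refl , y<e , s≤a
    go b y (a ∷ c) y<e (here s≤a)   | no s≰a = contradiction s≤a s≰a
    go b y (a ∷ c) y<e (there some) | no s≰a with b′ , x , a′ , c′ , eq , rest ← go [] a c (ℕ.<-≤-trans (ℕ.≰⇒> s≰a) s≤e) some
      = b ++ y ∷ b′ , x , a′ , c′ ,
        ≡.trans (cong (λ l → b ++ y ∷ l) eq) (sym (List.++-assoc b (y ∷ b′) _)) , rest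

  -- The right-hand side of the theorem, quantified over all redundant entries instead of anchored
  -- at the least one, with a larger entry y in place of M. In this form it makes sense when nothing
  -- is redundant.
  Good : List ℕ → Set
  Good l = ∀ x t y → Redundant x l → x < t * m → t * m < y → y ∈ˡ l → 1 < occurrences (t * m) l

  good-↭ : ∀ {l l′} → l ↭ l′ → Good l → Good l′
  good-↭ p good x t y red lt₁ lt₂ y∈ = subst (1 <_) (occurrences-↭ (t * m) p)
    (good x t y (redundant-↭ (↭-sym p) red) lt₁ lt₂ (∈-resp-↭ (↭-sym p) y∈))

  -- Dropping i lowers only the count of i itself, and a multiple of m above some redundant entry is
  -- not the least redundant one.
  good-tail : ∀ {i l} → Minimal i (i ∷ l) → Good (i ∷ l) → Good l
  good-tail {i} {l} (_ , min) good x t y red x<tm tm<y y∈ =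
    subst (1 <_) (occurrences-there l (λ { refl → ℕ.<⇒≱ x<tm (min x (redundant-∷ (t * m) red)) }))
      (good x t y (redundant-∷ i red) x<tm tm<y (there y∈))

  Move : List ℕ → List ℕ → Set
  Move l l′ = Valid l × Valid l′ × (Swap l l′ ⊎ Swap l′ l)

  move-↭ : ∀ {l l′} → Move l l′ → l ↭ l′
  move-↭ (_ , _ , inj₁ s) = swap-↭ s
  move-↭ (_ , _ , inj₂ s) = ↭-sym (swap-↭ s)

  move-sym : ∀ {l l′} → Move l l′ → Move l′ l
  move-sym (v , v′ , s) = v′ , v , Sum.swap s

  -- The largest multiple s of m below the last entry suc e and another entry of
  -- [s, suc e) both come before it.
  ascent : ∀ {e l i} → Valid (suc e ∷ l) → Good (suc e ∷ l) → Redundant i (suc e ∷ l) → i < suc e →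
           Ascent (e / m * m) (suc e) l
  ascent {e} {l} {i} val good red i<e = before⇒ascent (ℕ.<⇒≤ s<e) (weaken two)
    where
    -- Dividing e rather than `suc e` gives the largest multiple strictly below the last entry, also
    -- when that entry is itself a multiple of m.
    t = e / m
    s = t * m
    s<e : s < suc e
    s<e = s≤s (m/n*n≤m e m)
    Q : ℕ → Set
    Q y = s ≤ y × y < suc e
    weaken : Before Q Q l → Before (_< suc e) (s ≤_) l
    weaken (b , y , c , eq , q , some) = b , y , c , eq , proj₂ q , Any.map proj₁ some
    two : Before Q Q l
    -- If i < s, the hypothesis doubles s; if s < i, then s and i are two entries; if s = i, a
    -- redundant multiple of m is repeated.
    two with ℕ.<-cmp s i
    ... | tri> _ _ i<s = repeated-before l (subst (1 <_) (occurrences-there l (ℕ.<⇒≢ s<e)) (good i t (suc e) red i<s s<e (here refl)))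
                           (ℕ.≤-refl , s<e)
    ... | tri< s<i _ _ = distinct-before (closed (valid-tail val) i∈l t (ℕ.<⇒≤ s<i)) i∈l (ℕ.<⇒≢ s<i)
                           (ℕ.≤-refl , s<e) (ℕ.<⇒≤ s<i , i<e)
      where i∈l = ∈-tail (redundant-∈ red) (ℕ.<⇒≢ i<e)
    ... | tri≈ _ refl _ = repeated-before l (subst (1 <_) (occurrences-there l (ℕ.<⇒≢ s<e)) (∣-redundant {l = suc e ∷ l} (divides-refl t) red))
                            (ℕ.≤-refl , s<e)

  lower-last : ∀ {e l i} → Valid (e ∷ l) → Good (e ∷ l) → Redundant i (e ∷ l) → i < e →
               ∃[ e′ ] ∃[ l′ ] e′ < e × Move (e ∷ l) (e′ ∷ l′)
  lower-last {suc e} val good red i<e with b , x , a , c , refl , x<e , s≤a ← ascent val good red i<e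
    = x , b ++ suc e ∷ a ∷ c , x<e , val , exchange-valid b c val x<e nxt , inj₁ (swap [] b (a ∷ c) x<e)
    where
    -- A multiple of m below `suc e` is at most s, hence at most a.
    nxt : Next a (suc e)
    nxt u um<e = ℕ.≤-trans (ℕ.*-monoˡ-≤ m (subst (_≤ e / m) (m*n/n≡m u m) (/-monoˡ-≤ m (s≤s⁻¹ um<e)))) s≤a

  -- Each move lowers the last entry, and it cannot fall below i: a last entry below i would itself
  -- be redundant, because i was reached before it.
  settle-last : ∀ {e l i} → Acc _<_ e → Valid (e ∷ l) → Good (e ∷ l) → Minimal i (e ∷ l) →
                ∃[ l′ ] Valid (i ∷ l′) × Star Move (e ∷ l) (i ∷ l′)
  settle-last {e} {l} {i} (acc rs) val good min with ℕ.<-cmp e i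
  ... | tri≈ _ refl _ = l , val , ε
  ... | tri< e<i _ _  = contradiction (proj₂ min e (earlier-redundant val (∈-tail (redundant-∈ (proj₁ min)) (ℕ.>⇒≢ e<i)) e<i)) (ℕ.<⇒≱ e<i)
  ... | tri> _ _ i<e with lower-last val good (proj₁ min) i<e
  ...   | e′ , l′ , e′<e , mv with settle-last (rs e′<e) (proj₁ (proj₂ mv)) (good-↭ (move-↭ mv) good) (minimal-↭ (move-↭ mv) min)
  ...     | l″ , val″ , path = l″ , val″ , mv ◅ path

  path-↭ : ∀ {l l′} → Star Move l l′ → l ↭ l′
  path-↭ ε           = refl
  path-↭ (mv ◅ path) = trans (move-↭ mv) (path-↭ path)

  -- If i could not follow the last entry a of `l′`, some multiple of m would lie above a and below
  -- i. It occurs in `l′` left of a, so a would be redundant and smaller than i.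
  minimal-last : ∀ {i l l′} → Minimal i (i ∷ l) → Valid (i ∷ l) → l ↭ l′ → Valid l′ → Valid (i ∷ l′)
  minimal-last {i} {[]}    {[]}     _ val _ _ = val
  minimal-last {i} {_ ∷ _} {[]}     _ _   p _ with () ← ↭-length p
  minimal-last {i} {l}     {a ∷ l′} min val p val′ = nxt ∷ val′
    where
    nxt : Next a i
    nxt t tm<i = ℕ.≮⇒≥ λ a<tm →
      let tm∈l′ = ∈-tail (∈-resp-↭ p (∈-tail (closed val (here refl) t (ℕ.<⇒≤ tm<i)) (ℕ.<⇒≢ tm<i))) (ℕ.>⇒≢ a<tm)
      in ℕ.<⇒≱ (ℕ.<-trans a<tm tm<i)
           (proj₂ min a (redundant-∷ i (redundant-↭ (↭-sym p) (earlier-redundant val′ tm∈l′ a<tm))))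

  lift-path : ∀ {i l l₁ l₂} → Minimal i (i ∷ l) → Valid (i ∷ l) → l ↭ l₁ →
              Star Move l₁ l₂ → Star Move (i ∷ l₁) (i ∷ l₂)
  lift-path min val p ε = ε
  lift-path {i} min val p (mv@(v , v′ , s) ◅ path) =
    (minimal-last min val p v , minimal-last min val p′ v′ , Sum.map (swap-∷ i) (swap-∷ i) s) ◅ lift-path min val p′ path
    where p′ = trans p (move-↭ mv)

  staircase : ℕ → List ℕ
  staircase zero    = []
  staircase (suc n) = n * m ∷ staircase n

  ∈-staircase : ∀ {n} t → t < n → t * m ∈ˡ staircase n
  ∈-staircase {suc n} t t<1+n with ℕ.m≤n⇒m<n∨m≡n (s≤s⁻¹ t<1+n)
  ... | inj₁ t<n  = there (∈-staircase t t<n)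
  ... | inj₂ refl = here refl

  -- Every entry is then a multiple of m; one already passed would be repeated, and one beyond the
  -- next would skip a step.
  irredundant : ∀ {l} → Valid l → (∀ x → ¬ Redundant x l) → l ≡ staircase (length l)
  irredundant []    _    = refl
  irredundant first _    = refl
  irredundant {e ∷ l@(a ∷ l₀)} val@(nxt ∷ val′) none with m ∣? e
  ... | no m∤e = contradiction (∤-redundant (here refl) m∤e) (none e)
  ... | yes (divides t refl) = cong₂ _∷_ (cong (_* m) t≡) ih
    where
    ih : l ≡ staircase (length l)
    ih = irredundant val′ λ x red → none x (redundant-∷ _ red)
    a≡ : a ≡ length l₀ * m
    a≡ = List.∷-injectiveˡ ih
    t≡ : t ≡ length l
    t≡ with ℕ.<-cmp t (length l)
    ... | tri≈ _ eq _ = eq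
    ... | tri< lt _ _ = contradiction (repeated-redundant (subst (t * m ∈ˡ_) (sym ih) (∈-staircase t lt))) (none (t * m))
    ... | tri> _ _ gt = contradiction (ℕ.≤-trans (nxt (length l) (ℕ.*-monoˡ-< m gt)) (ℕ.≤-reflexive a≡))
                          (ℕ.<⇒≱ (ℕ.*-monoˡ-< m (ℕ.n<1+n (length l₀))))

  connected : ∀ n {l l′} → length l ≡ n → Valid l → Valid l′ → l ↭ l′ → Good l → Star Move l l′
  connected zero {[]} {[]}    _   _   _    _ _    = ε
  connected zero {[]} {_ ∷ _} _   _   _    p _    with () ← ↭-length p
  connected (suc n) {_ ∷ _} {[]} _ _  _    p _    with () ← ↭-length p
  connected (suc n) {l@(e ∷ _)} {l′@(e′ ∷ _)} len val val′ p good with minimal-redundant l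
  ... | inj₁ none = subst (Star Move l) (≡.trans (irredundant val none)
          (≡.trans (cong staircase (↭-length p)) (sym (irredundant val′ λ x red → none x (redundant-↭ (↭-sym p) red))))) ε
  ... | inj₂ (i , min)
    with k  , val-k  , path  ← settle-last (<-wellFounded e) val good min
       | k′ , val-k′ , path′ ← settle-last (<-wellFounded e′) val′ (good-↭ p good) (minimal-↭ p min)
    = path ◅◅ lift-path min-k val-k refl (connected n len-k (valid-tail val-k) (valid-tail val-k′) k↭k′ (good-tail min-k (good-↭ (path-↭ path) good)))
           ◅◅ Star.reverse move-sym path′
    where
    min-k = minimal-↭ (path-↭ path) min
    len-k = ℕ.suc-injective (≡.trans (sym (↭-length (path-↭ path))) len)
    k↭k′  = drop-∷ (trans (↭-sym (path-↭ path)) (trans p (path-↭ path′)))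

-- Boards and lists of heights

module _ {R : Rel ℕ 0ℓ} where

  toList-linked : ∀ {n} {xs : Vec ℕ n} → VecLinked.Linked R xs → ListLinked.Linked R (toList xs)
  toList-linked []                          = []
  toList-linked [-]                         = [-]
  toList-linked (_∷_ {xs = _ ∷ _} Rxy link) = Rxy ∷ toList-linked link

  fromList-linked : ∀ {xs} → ListLinked.Linked R xs → VecLinked.Linked R (fromList xs)
  fromList-linked []           = []
  fromList-linked [-]          = [-]
  fromList-linked (Rxy ∷ link) = Rxy ∷ fromList-linked link

  ʳ++-linked : ∀ {x xs ys} → ListLinked.Linked R (x ∷ xs) → ListLinked.Linked (flip R) (x ∷ ys) →
               ListLinked.Linked (flip R) (xs ʳ++ x ∷ ys)
  ʳ++-linked [-]          link′ = link′
  ʳ++-linked (Rxy ∷ link) link′ = ʳ++-linked link (Rxy ∷ link′)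

  reverse-linked : ∀ {xs} → ListLinked.Linked R xs → ListLinked.Linked (flip R) (reverse xs)
  reverse-linked {[]}     _    = []
  reverse-linked {x ∷ xs} link = ʳ++-linked link [-]

reverse-++-∷ : ∀ {A : Set} (xs : List A) {x ys} → reverse (xs ++ x ∷ ys) ≡ reverse ys ++ x ∷ reverse xs
reverse-++-∷ xs {x} {ys} = ≡.trans (List.reverse-++ xs (x ∷ ys))
  (≡.trans (cong (_++ reverse xs) (List.unfold-reverse x ys)) (List.++-assoc (reverse ys) (x ∷ []) (reverse xs)))

⊑₀-toList : ∀ {n N} {xs : Vec ℕ n} (ys : Vec ℕ N) p → toList ys ≡ replicate p 0 ++ toList xs → xs ⊑₀ ys
⊑₀-toList {xs = xs} ys zero eq
  with refl ← ≡.trans (sym (Vec.length-toList xs)) (≡.trans (cong length (sym eq)) (Vec.length-toList ys))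
  with refl ← ≡.trans (sym (Vec.cast-is-id refl ys)) (Vec.toList-injective refl ys xs eq)
  = same
⊑₀-toList (y ∷ ys) (suc p) eq with refl ← List.∷-injectiveˡ eq = pad (⊑₀-toList ys p (List.∷-injectiveʳ eq))

lookup-middle : ∀ {a n} (A : Vec ℕ a) x (D : Vec ℕ n) → lookup (A Vec.++ x ∷ D) (a ↑ʳ Fin.zero) ≡ x
lookup-middle A x D = Vec.lookup-++ʳ A (x ∷ D) Fin.zero

lookup-elsewhere : ∀ {a n} (A : Vec ℕ a) x y (D : Vec ℕ n) l → l ≢ a ↑ʳ Fin.zero →
                   lookup (A Vec.++ x ∷ D) l ≡ lookup (A Vec.++ y ∷ D) l
lookup-elsewhere []      x y D Fin.zero    l≢ = contradiction refl l≢
lookup-elsewhere []      x y D (Fin.suc l) l≢ = refl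
lookup-elsewhere (_ ∷ A) x y D Fin.zero    l≢ = refl
lookup-elsewhere (_ ∷ A) x y D (Fin.suc l) l≢ = lookup-elsewhere A x y D l (l≢ ∘ cong Fin.suc)

movesCells-∷ : ∀ {N} x {C₁ C₂ : Vec ℕ N} → MovesCells C₁ C₂ → MovesCells (x ∷ C₁) (x ∷ C₂)
movesCells-∷ x {C₁} {C₂} (i , j , k , 0<k , eqᵢ , eqⱼ , rest) =
  Fin.suc i , Fin.suc j , k , 0<k , eqᵢ , eqⱼ , others
  where
  others : ∀ l → l ≢ Fin.suc i → l ≢ Fin.suc j → lookup (x ∷ C₁) l ≡ lookup (x ∷ C₂) l
  others Fin.zero    _  _  = refl
  others (Fin.suc l) ≢i ≢j = rest l (≢i ∘ cong Fin.suc) (≢j ∘ cong Fin.suc)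

movesCells : ∀ {a b c} (A : Vec ℕ a) (B : Vec ℕ b) (C : Vec ℕ c) x y {k} → 0 < k →
             MovesCells (A Vec.++ (x + k) ∷ B Vec.++ y ∷ C) (A Vec.++ x ∷ B Vec.++ (y + k) ∷ C)
movesCells (z ∷ A) B C x y {k} 0<k = movesCells-∷ z {C₁ = A Vec.++ (x + k) ∷ B Vec.++ y ∷ C} {C₂ = A Vec.++ x ∷ B Vec.++ (y + k) ∷ C} (movesCells A B C x y 0<k)
movesCells {b = b} [] B C x y {k} 0<k =
  Fin.zero , Fin.suc (b ↑ʳ Fin.zero) , k , 0<k , refl ,
  ≡.trans (cong (_+ k) (lookup-middle B y C)) (sym (lookup-middle B (y + k) C)) , others
  where
  others : ∀ l → l ≢ Fin.zero → l ≢ Fin.suc (b ↑ʳ Fin.zero) →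
           lookup ((x + k) ∷ B Vec.++ y ∷ C) l ≡ lookup (x ∷ B Vec.++ (y + k) ∷ C) l
  others Fin.zero    ≢0 _  = contradiction refl ≢0
  others (Fin.suc l) _  ≢j = lookup-elsewhere B y (y + k) C l (≢j ∘ cong Fin.suc)

movesCells-sym : ∀ {N} {C₁ C₂ : Vec ℕ N} → MovesCells C₁ C₂ → MovesCells C₂ C₁
movesCells-sym (i , j , k , 0<k , eqᵢ , eqⱼ , rest) =
  j , i , k , 0<k , sym eqⱼ , sym eqᵢ , λ l ≢j ≢i → sym (rest l ≢i ≢j)

adjacent-sym : ∀ {n₁ n₂} {B₁ : Board n₁} {B₂ : Board n₂} → Adjacent B₁ B₂ → Adjacent B₂ B₁
adjacent-sym (N , C₁ , C₂ , ⊑₁ , ⊑₂ , mv) = N , C₂ , C₁ , ⊑₂ , ⊑₁ , movesCells-sym {C₁ = C₁} {C₂} mv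


-- Column heights from the last column to the first, zero columns padded.
Represents : ∀ {n} → Board n → List ℕ → Set
Represents B hs = ∃[ p ] reversedHeights B ++ replicate p 0 ≡ hs

represents-⊑₀ : ∀ {n N} {B : Board n} {hs} (C : Vec ℕ N) → Represents B hs → toList C ≡ reverse hs → heights B ⊑₀ C
represents-⊑₀ {B = B} C (p , refl) eq = ⊑₀-toList C p (begin
  toList C                                             ≡⟨ eq ⟩
  reverse (reversedHeights B ++ replicate p 0)         ≡⟨ List.reverse-++ (reversedHeights B) (replicate p 0) ⟩
  reverse (replicate p 0) ++ reverse (reversedHeights B) ≡⟨ cong₂ _++_ (reverse-replicate p) (List.reverse-involutive (toList (heights B))) ⟩
  replicate p 0 ++ toList (heights B)                  ∎)
  where
  open ≡-Reasoning
  replicate-∷ʳ : ∀ p → replicate p 0 ++ 0 ∷ [] ≡ 0 ∷ replicate p 0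
  replicate-∷ʳ zero    = refl
  replicate-∷ʳ (suc p) = cong (0 ∷_) (replicate-∷ʳ p)
  reverse-replicate : ∀ p → reverse (replicate p 0) ≡ replicate p 0
  reverse-replicate zero    = refl
  reverse-replicate (suc p) = ≡.trans (List.unfold-reverse 0 (replicate p 0))
    (≡.trans (cong (_++ 0 ∷ []) (reverse-replicate p)) (replicate-∷ʳ p))

represents-≋ : ∀ {n₁ n₂} {B₁ : Board n₁} {B₂ : Board n₂} {hs} → Represents B₁ hs → Represents B₂ hs → B₁ ≋ B₂
represents-≋ {B₁ = B₁} {B₂} {hs} rep₁ rep₂ =
  _ , fromList (reverse hs) , represents-⊑₀ {B = B₁} _ rep₁ (Vec.toList∘fromList (reverse hs)) ,
                              represents-⊑₀ {B = B₂} _ rep₂ (Vec.toList∘fromList (reverse hs))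

represents-adjacent : ∀ {n₁ n₂} {B₁ : Board n₁} {B₂ : Board n₂} a b c x y {k} → 0 < k →
  Represents B₁ (a ++ x ∷ b ++ (y + k) ∷ c) → Represents B₂ (a ++ (x + k) ∷ b ++ y ∷ c) → Adjacent B₁ B₂
represents-adjacent {B₁ = B₁} {B₂} a b c x y {k} 0<k rep₁ rep₂ =
  _ , C (y + k) x , C y (x + k) ,
  represents-⊑₀ {B = B₁} _ rep₁ (toList-C (y + k) x) ,
  represents-⊑₀ {B = B₂} _ rep₂ (toList-C y (x + k)) ,
  movesCells (fromList (reverse c)) (fromList (reverse b)) (fromList (reverse a)) y x 0<k
  where
  C : (y x : ℕ) → Vec ℕ _
  C y x = fromList (reverse c) Vec.++ y ∷ fromList (reverse b) Vec.++ x ∷ fromList (reverse a)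
  toList-C : ∀ y x → toList (C y x) ≡ reverse (a ++ x ∷ b ++ y ∷ c)
  toList-C y x = begin
    toList (C y x)
      ≡⟨ Vec.toList-++ (fromList (reverse c)) _ ⟩
    toList (fromList (reverse c)) ++ y ∷ toList (fromList (reverse b) Vec.++ x ∷ fromList (reverse a))
      ≡⟨ cong₂ (λ u w → u ++ y ∷ w) (Vec.toList∘fromList (reverse c)) (≡.trans (Vec.toList-++ (fromList (reverse b)) _)
           (cong₂ (λ u w → u ++ x ∷ w) (Vec.toList∘fromList (reverse b)) (Vec.toList∘fromList (reverse a)))) ⟩
    reverse c ++ y ∷ reverse b ++ x ∷ reverse a
      ≡⟨ cong (λ u → reverse c ++ y ∷ u) (reverse-++-∷ a) ⟨
    reverse c ++ y ∷ reverse (a ++ x ∷ b)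
      ≡⟨ reverse-++-∷ (a ++ x ∷ b) ⟨
    reverse ((a ++ x ∷ b) ++ y ∷ c)
      ≡⟨ cong reverse (List.++-assoc a (x ∷ b) (y ∷ c)) ⟩
    reverse (a ++ x ∷ b ++ y ∷ c) ∎
    where open ≡-Reasoning

module _ (m : ℕ) .{{_ : NonZero m}} where

  -- zs is the root vector of the column heights hs, both from the last column
  -- to the first.
  data Roots : List ℕ → List ℕ → Set where
    []  : Roots [] []
    _∷_ : ∀ {h hs z zs} → z + h ≡ m * length hs → Roots hs zs → Roots (h ∷ hs) (z ∷ zs)

  roots-length : ∀ {hs zs} → Roots hs zs → length hs ≡ length zs
  roots-length []       = refl
  roots-length (_ ∷ rs) = cong suc (roots-length rs)

  roots-functional : ∀ {hs hs′ zs} → Roots hs zs → Roots hs′ zs → hs ≡ hs′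
  roots-functional []         []           = refl
  roots-functional (_∷_ {z = z} eq rs) (eq′ ∷ rs′) with refl ← roots-functional rs rs′ =
    cong (_∷ _) (ℕ.+-cancelˡ-≡ z _ _ (≡.trans eq (sym eq′)))

  roots⇒Roots : ∀ hs {zs} → roots m hs ≡ map +_ zs → Roots hs zs
  roots⇒Roots []       {[]}     _  = []
  roots⇒Roots (h ∷ hs) {z ∷ zs} eq = ℤ.+-injective
    (≡.trans (cong (ℤ._+ + h) (sym (List.∷-injectiveˡ eq))) (lemma (+ (m * length hs)) (+ h)))
    ∷ roots⇒Roots hs (List.∷-injectiveʳ eq)
    where
    lemma : ∀ c h → c ℤ.- h ℤ.+ h ≡ c
    lemma = ℤ-Solver.solve-∀

  Roots⇒roots : ∀ {hs zs} → Roots hs zs → roots m hs ≡ map +_ zs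
  Roots⇒roots []                            = refl
  Roots⇒roots (_∷_ {h} {hs} {z} eq rs) = cong₂ _∷_
    (≡.trans (cong (λ c → + c ℤ.- + h) (sym eq)) (lemma (+ z) (+ h))) (Roots⇒roots rs)
    where
    lemma : ∀ z h → z ℤ.+ h ℤ.- h ≡ z
    lemma = ℤ-Solver.solve-∀

  *-split : ∀ u t {L} → u + t ≡ L → u * m + t * m ≡ m * L
  *-split u t refl = ≡.trans (sym (ℕ.*-distribʳ-+ m u t)) (ℕ.*-comm (u + t) m)

  module _ {a e h h′ L : ℕ} (eq′ : a + h′ ≡ m * L) (eq : e + h ≡ m * suc L) where

    -- Both relations say that no multiple u m satisfies a < u m < e. Under the substitution t = L -
    -- u, the inequality t m < h′ becomes a < u m, and (t + 1) m ≤ h becomes e ≤ u m.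
    next⇒≼ : Next m a e → _≼_ m h′ h
    next⇒≼ nxt t tm<h′ = ℕ.+-cancelˡ-≤ (u * m) _ _ (begin
      u * m + suc t * m ≡⟨ *-split u (suc t) (≡.trans (ℕ.+-suc u t) (cong suc u+t≡L)) ⟩
      m * suc L         ≡⟨ eq ⟨
      e + h             ≤⟨ ℕ.+-monoˡ-≤ h e≤um ⟩
      u * m + h         ∎)
      where
      open ℕ.≤-Reasoning
      u = L ∸ t
      t≤L : t ≤ L
      t≤L = ℕ.*-cancelʳ-≤ t L m (ℕ.≤-trans (ℕ.<⇒≤ tm<h′) (ℕ.≤-trans (ℕ.m≤n+m h′ a) (ℕ.≤-reflexive (≡.trans eq′ (ℕ.*-comm m L)))))
      u+t≡L : u + t ≡ L
      u+t≡L = ℕ.m∸n+n≡m t≤L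
      e≤um : e ≤ u * m
      e≤um = ℕ.≮⇒≥ λ um<e → ℕ.<-irrefl (≡.trans (*-split u t u+t≡L) (sym eq′)) (ℕ.+-mono-≤-< (nxt u um<e) tm<h′)

    ≼⇒next : _≼_ m h′ h → Next m a e
    ≼⇒next h′≼h u um<e = ℕ.≮⇒≥ λ a<um → ℕ.<-irrefl
      (≡.trans (*-split u (suc t) (≡.trans (ℕ.+-suc u t) (cong suc u+t≡L))) (sym eq))
      (ℕ.+-mono-<-≤ um<e (h′≼h t (ℕ.+-cancelˡ-< (u * m) _ _ (begin-strict
        u * m + t * m ≡⟨ *-split u t u+t≡L ⟩
        m * L         ≡⟨ eq′ ⟨
        a + h′        <⟨ ℕ.+-monoˡ-< h′ a<um ⟩
        u * m + h′    ∎))))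
      where
      open ℕ.≤-Reasoning
      t = L ∸ u
      u≤L : u ≤ L
      u≤L = s≤s⁻¹ (ℕ.*-cancelʳ-< m u (suc L) (ℕ.<-≤-trans um<e (ℕ.≤-trans (ℕ.m≤m+n e h) (ℕ.≤-reflexive (≡.trans eq (ℕ.*-comm m (suc L)))))))
      u+t≡L : u + t ≡ L
      u+t≡L = ℕ.m+[n∸m]≡n u≤L

  Chain : List ℕ → Set
  Chain = ListLinked.Linked (flip (_≼_ m))

  valid⇒chain : ∀ {hs zs} → Roots hs zs → Valid m zs → Chain hs
  valid⇒chain []                     _           = []
  valid⇒chain (_ ∷ [])               _           = [-]
  valid⇒chain (eq ∷ rs@(eq′ ∷ _)) (nxt ∷ val) = next⇒≼ eq′ eq nxt ∷ valid⇒chain rs val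

  chain⇒valid : ∀ {hs zs} → Roots hs zs → Chain hs → Valid m zs
  chain⇒valid []                  _            = []
  -- The leftmost column has no offset, so a root that is a natural number must be 0.
  chain⇒valid (_∷_ {z = z} eq []) _            with refl ← ℕ.m+n≡0⇒m≡0 z (≡.trans eq (ℕ.*-zeroʳ m)) = first
  chain⇒valid (eq ∷ rs@(eq′ ∷ _)) (h′≼h ∷ link) = ≼⇒next eq′ eq h′≼h ∷ chain⇒valid rs link

  -- Exceeding the bound would force the predecessor to reach the same multiple of m, beyond its own
  -- bound. This makes the truncated subtraction in `heightsOf` exact.
  valid-bound : ∀ {z zs} → Valid m (z ∷ zs) → z ≤ m * length zs
  valid-bound first = z≤n
  valid-bound {e} {a ∷ l} (nxt ∷ val) = ℕ.≮⇒≥ λ lt →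
    ℕ.<⇒≱ (ℕ.m<n+m (m * length l) (>-nonZero⁻¹ m))
      (ℕ.≤-trans (ℕ.≤-reflexive (≡.trans (sym (ℕ.*-suc m (length l))) (ℕ.*-comm m _)))
        (ℕ.≤-trans (nxt (suc (length l)) (subst (_< e) (ℕ.*-comm m (suc (length l))) lt)) (valid-bound val)))

  heightsOf : ∀ {zs} → Valid m zs → ∃[ hs ] Roots hs zs
  heightsOf {[]}     _   = [] , []
  heightsOf {z ∷ zs} val with hs , rs ← heightsOf (valid-tail m val) =
    m * length hs ∸ z ∷ hs ,
    ℕ.m+[n∸m]≡n (subst (λ l → z ≤ m * l) (sym (roots-length rs)) (valid-bound val)) ∷ rs

  roots-replace : ∀ {x k c} b {hs hs′} → Roots hs (b ++ x ∷ c) → Roots hs′ (b ++ (x + k) ∷ c) →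
                  ∃[ B ] ∃[ h ] ∃[ C ] hs ≡ B ++ (h + k) ∷ C × hs′ ≡ B ++ h ∷ C
  roots-replace {x} {k} [] (eq ∷ rs) (_∷_ {h′} {hs′} eq′ rs′) with refl ← roots-functional rs rs′ =
    [] , h′ , hs′ , cong (_∷ hs′) (ℕ.+-cancelˡ-≡ x _ _ (≡.trans eq (≡.trans (sym eq′) shuffle))) , refl
    where
    shuffle : x + k + h′ ≡ x + (h′ + k)
    shuffle = ≡.trans (ℕ.+-assoc x k h′) (cong (λ n → x + n) (ℕ.+-comm k h′))
  roots-replace (y ∷ b) (_∷_ {h} {hs} eq rs) (_∷_ {hs = hs′} eq′ rs′) with B , g , C , p , p′ ← roots-replace b rs rs′ =
    h ∷ B , g , C , cong (h ∷_) p ,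
    cong₂ _∷_ (ℕ.+-cancelˡ-≡ y _ _ (≡.trans eq′ (≡.trans (cong (m *_) len) (sym eq)))) p′
    where
    len : length hs′ ≡ length hs
    len = ≡.trans (cong length p′) (≡.trans (List.length-++ B) (≡.trans (sym (List.length-++ B)) (cong length (sym p))))

  -- At a fixed width, exchanging roots e > x raises the later column by e - x and lowers the
  -- earlier one by as much.
  swap⇒adjacent : ∀ {n₁ n₂} {B₁ : Board n₁} {B₂ : Board n₂} {hs hs′ zs zs′} → Swap zs zs′ →
    Roots hs zs → Roots hs′ zs′ → Represents B₁ hs → Represents B₂ hs′ → Adjacent B₁ B₂
  swap⇒adjacent {B₁ = B₁} {B₂} (swap a b c {e} {x} x<e) rs rs′ rep rep′ = go a [] rs rs′ rep rep′
    where
    k = e ∸ x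
    e≡ : x + k ≡ e
    e≡ = ℕ.m+[n∸m]≡n (ℕ.<⇒≤ x<e)
    -- `T` accumulates the columns to the right of the exchange, on which both boards agree.
    go : ∀ a T {hs hs′} → Roots hs (a ++ e ∷ b ++ x ∷ c) → Roots hs′ (a ++ x ∷ b ++ e ∷ c) →
         Represents B₁ (T ++ hs) → Represents B₂ (T ++ hs′) → Adjacent B₁ B₂
    go [] T (_∷_ {h} {hs} eq rs) (_∷_ {h′} {hs′} eq′ rs′) rep rep′
      with B , g , C , refl , refl ← roots-replace b rs (subst (λ e → Roots hs′ (b ++ e ∷ c)) (sym e≡) rs′)
      = represents-adjacent {B₁ = B₁} {B₂} T B C h g (ℕ.m<n⇒0<n∸m x<e) rep (subst (λ h → Represents B₂ (T ++ h ∷ B ++ g ∷ C)) h≡ rep′)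
      where
      len : length (B ++ g ∷ C) ≡ length (B ++ (g + k) ∷ C)
      len = ≡.trans (List.length-++ B) (sym (List.length-++ B))
      h≡ : h′ ≡ h + k
      h≡ = ℕ.+-cancelˡ-≡ x _ _ (begin
        x + h′ ≡⟨ eq′ ⟩
        m * length (B ++ g ∷ C) ≡⟨ cong (m *_) len ⟩
        m * length (B ++ (g + k) ∷ C) ≡⟨ eq ⟨
        e + h ≡⟨ cong (_+ h) e≡ ⟨
        x + k + h ≡⟨ ℕ.+-assoc x k h ⟩
        x + (k + h) ≡⟨ cong (λ n → x + n) (ℕ.+-comm k h) ⟩
        x + (h + k) ∎)
        where open ≡-Reasoning
    go (y ∷ a) T (_∷_ {h} {hs} eq rs) (_∷_ {h′} {hs′} eq′ rs′) rep rep′ =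
      go a (T ++ h ∷ []) rs rs′
        (subst (Represents B₁) (sym (List.++-assoc T (h ∷ []) hs)) rep)
        (subst (Represents B₂) (≡.trans (cong (λ h → T ++ h ∷ hs′) h≡) (sym (List.++-assoc T (h ∷ []) hs′))) rep′)
      where
      h≡ : h′ ≡ h
      h≡ = ℕ.+-cancelˡ-≡ y _ _ (≡.trans eq′ (≡.trans (cong (m *_) (begin
        length hs′ ≡⟨ roots-length rs′ ⟩
        length (a ++ x ∷ b ++ e ∷ c) ≡⟨ ↭-length (swap-↭ (swap a b c x<e)) ⟨
        length (a ++ e ∷ b ++ x ∷ c) ≡⟨ roots-length rs ⟨
        length hs ∎)) (sym eq)))
        where open ≡-Reasoning

-- Root vectors of boards, padding and rook equivalence

count-toList : ∀ {A : Set} {P : Pred A 0ℓ} (P? : Decidable P) {n} (xs : Vec A n) →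
               Vec.count P? xs ≡ length (filter P? (toList xs))
count-toList P? []       = refl
count-toList P? (x ∷ xs) with P? x
... | yes _ = cong suc (count-toList P? xs)
... | no  _ = count-toList P? xs

toList-All : ∀ {A : Set} {P : Pred A 0ℓ} {n} {xs : Vec A n} → All P xs → ListAll.All P (toList xs)
toList-All []         = []
toList-All (px ∷ pxs) = px ∷ toList-All pxs

nonNegative-map : ∀ {zs} → ListAll.All (0ℤ ℤ.≤_) zs → ∃[ ns ] zs ≡ map +_ ns
nonNegative-map []                  = [] , refl
nonNegative-map (ℤ.+≤+ {n = n} _ ∷ nneg) with ns , refl ← nonNegative-map nneg = n ∷ ns , refl

module _ (m : ℕ) .{{_ : NonZero m}} where

  rootsFrom : ℕ → List ℕ → List ℤ
  rootsFrom j []       = []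
  rootsFrom j (h ∷ hs) = (+ (m * j) ℤ.- + h) ∷ rootsFrom (suc j) hs

  toList-ξ : ∀ {n} j (hs : Vec ℕ n) →
             toList (tabulate (λ i → + (m * (j + toℕ i)) ℤ.- + lookup hs i)) ≡ rootsFrom j (toList hs)
  toList-ξ j []       = refl
  toList-ξ j (h ∷ hs) = cong₂ _∷_ (cong (λ c → + (m * c) ℤ.- + h) (ℕ.+-identityʳ j))
    (≡.trans (cong toList (Vec.tabulate-cong λ i → cong (λ c → + (m * c) ℤ.- + lookup hs i) (ℕ.+-suc j (toℕ i))))
      (toList-ξ (suc j) hs))

  roots-ʳ++ : ∀ hs gs → roots m (hs ʳ++ gs) ≡ rootsFrom (length gs) hs ʳ++ roots m gs
  roots-ʳ++ []       gs = refl
  roots-ʳ++ (h ∷ hs) gs = roots-ʳ++ hs (h ∷ gs)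

  roots-reversedHeights : ∀ {n} (B : Board n) → roots m (reversedHeights B) ≡ reverse (toList (ξ m B))
  roots-reversedHeights B = ≡.trans (roots-ʳ++ (toList (heights B)) []) (cong reverse (sym (toList-ξ 0 (heights B))))

  board-roots : ∀ {n} (B : Board n) → All (0ℤ ℤ.≤_) (ξ m B) → ∃[ zs ] Roots m (reversedHeights B) zs
  board-roots B nneg
    with zs , eq ← nonNegative-map (All-resp-↭ (↭-sym (↭-reverse (toList (ξ m B)))) (toList-All nneg))
    = zs , roots⇒Roots m (reversedHeights B) (≡.trans (roots-reversedHeights B) eq)

  v-occurrences : ∀ {n} (B : Board n) {zs} → Roots m (reversedHeights B) zs → ∀ x → v m B (+ x) ≡ occurrences x zs
  v-occurrences B {zs} rs x = begin
    Vec.count (+ x ℤ.≟_) (ξ m B)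
      ≡⟨ count-toList (+ x ℤ.≟_) (ξ m B) ⟩
    length (filter (+ x ℤ.≟_) (toList (ξ m B)))
      ≡⟨ ↭-length (filter-↭ (+ x ℤ.≟_) (↭-reverse (toList (ξ m B)))) ⟨
    length (filter (+ x ℤ.≟_) (reverse (toList (ξ m B))))
      ≡⟨ cong (λ l → length (filter (+ x ℤ.≟_) l)) (≡.trans (sym (roots-reversedHeights B)) (Roots⇒roots m rs)) ⟩
    length (filter (+ x ℤ.≟_) (map +_ zs))
      ≡⟨ length-filter-map (x ≟_) (+ x ℤ.≟_) +_ (λ _ eq → cong +_ eq) (λ _ → ℤ.+-injective) zs ⟩
    occurrences x zs ∎
    where open ≡-Reasoning

  v-entry : ∀ {n} (B : Board n) {zs} → Roots m (reversedHeights B) zs → ∀ k → v m B k ≢ 0 → ∃[ x ] k ≡ + x × x ∈ˡ zs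
  v-entry B {zs} rs k v≢0 = go zs λ none → v≢0 (begin
    Vec.count (k ℤ.≟_) (ξ m B)
      ≡⟨ count-toList (k ℤ.≟_) (ξ m B) ⟩
    length (filter (k ℤ.≟_) (toList (ξ m B)))
      ≡⟨ ↭-length (filter-↭ (k ℤ.≟_) (↭-reverse (toList (ξ m B)))) ⟨
    length (filter (k ℤ.≟_) (reverse (toList (ξ m B))))
      ≡⟨ cong (λ l → length (filter (k ℤ.≟_) l)) (≡.trans (sym (roots-reversedHeights B)) (Roots⇒roots m rs)) ⟩
    length (filter (k ℤ.≟_) (map +_ zs))
      ≡⟨ none ⟩
    0 ∎)
    where
    open ≡-Reasoning
    go : ∀ zs → length (filter (k ℤ.≟_) (map +_ zs)) ≢ 0 → ∃[ x ] k ≡ + x × x ∈ˡ zs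
    go []       ≢0 = contradiction refl ≢0
    go (z ∷ zs) ≢0 with k ℤ.≟ + z
    ... | yes eq = z , eq , here refl
    ... | no _ with x , eq , x∈ ← go zs ≢0
                 = x , eq , there x∈

  rooks-replicate : ∀ p → rooks m (replicate p 0) ≗ δ m
  rooks-replicate zero    k = refl
  rooks-replicate (suc p) k = ≡.trans (addColumn-cong m 0ℤ (rooks-replicate p) k) (lemma k)
    where
    lemma : ∀ k → addColumn m 0ℤ (δ m) k ≡ δ m k
    lemma zero          = refl
    lemma (suc zero)    = refl
    lemma (suc (suc k)) = ≡.trans (ℤ.+-identityˡ _) (ℤ.*-zeroʳ (0ℤ ℤ.- + (suc k * m)))

  rooks-pad : ∀ hs p → rooks m (hs ++ replicate p 0) ≗ rooks m hs
  rooks-pad []       p = rooks-replicate p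
  rooks-pad (h ∷ hs) p = addColumn-cong m (+ h) (rooks-pad hs p)

  padRoots : ℕ → List ℕ → List ℕ
  padRoots p zs = map (λ z → p * m + z) zs ++ staircase m p

  roots-staircase : ∀ p → Roots m (replicate p 0) (staircase m p)
  roots-staircase zero    = []
  roots-staircase (suc p) =
    ≡.trans (ℕ.+-identityʳ (p * m)) (≡.trans (ℕ.*-comm p m) (cong (m *_) (sym (List.length-replicate p)))) ∷ roots-staircase p

  roots-pad : ∀ {hs zs} p → Roots m hs zs → Roots m (hs ++ replicate p 0) (padRoots p zs)
  roots-pad p [] = roots-staircase p
  roots-pad p (_∷_ {h} {hs} {z} eq rs) = (begin
    p * m + z + h                      ≡⟨ ℕ.+-assoc (p * m) z h ⟩
    p * m + (z + h)                    ≡⟨ cong₂ _+_ (ℕ.*-comm p m) eq ⟩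
    m * p + m * length hs              ≡⟨ ℕ.*-distribˡ-+ m p (length hs) ⟨
    m * (p + length hs)                ≡⟨ cong (m *_) (ℕ.+-comm p (length hs)) ⟩
    m * (length hs + p)                ≡⟨ cong (λ l → m * (length hs + l)) (List.length-replicate p) ⟨
    m * (length hs + length (replicate p 0)) ≡⟨ cong (m *_) (List.length-++ hs) ⟨
    m * length (hs ++ replicate p 0)   ∎) ∷ roots-pad p rs
    where open ≡-Reasoning

  chain-pad : ∀ {hs} p → Chain m hs → Chain m (hs ++ replicate p 0)
  chain-pad zero          []           = []
  chain-pad (suc zero)    []           = [-]
  chain-pad (suc (suc p)) []           = (λ _ ()) ∷ chain-pad (suc p) []
  chain-pad zero          [-]          = [-]
  chain-pad (suc p)       [-]          = (λ _ ()) ∷ chain-pad (suc p) []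
  chain-pad p             (h≽ ∷ chain) = h≽ ∷ chain-pad p chain

  board-chain : ∀ {n} (B : Board n) → Singleton m B → Chain m (reversedHeights B)
  board-chain B sing = reverse-linked (toList-linked (board-≼ m B sing))

  occurrences-++ : ∀ x l l′ → occurrences x (l ++ l′) ≡ occurrences x l + occurrences x l′
  occurrences-++ x l l′ = ≡.trans (cong length (List.filter-++ (x ≟_) l l′)) (List.length-++ (filter (x ≟_) l))

  occurrences-staircase-none : ∀ {x} p → p * m ≤ x → occurrences x (staircase m p) ≡ 0
  occurrences-staircase-none zero    _  = refl
  occurrences-staircase-none {x} (suc p) le = ≡.trans (occurrences-there (staircase m p) (ℕ.>⇒≢ pm<x))
    (occurrences-staircase-none p (ℕ.<⇒≤ pm<x))
    where
    pm<x : p * m < x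
    pm<x = ℕ.<-≤-trans (ℕ.m<n+m (p * m) (>-nonZero⁻¹ m)) le

  occurrences-padRoots : ∀ p x zs → occurrences (p * m + x) (padRoots p zs) ≡ occurrences x zs
  occurrences-padRoots p x zs = begin
    occurrences (p * m + x) (padRoots p zs)
      ≡⟨ occurrences-++ (p * m + x) (map (λ z → p * m + z) zs) (staircase m p) ⟩
    occurrences (p * m + x) (map (λ z → p * m + z) zs) + occurrences (p * m + x) (staircase m p)
      ≡⟨ cong₂ _+_ (length-filter-map (x ≟_) (p * m + x ≟_) (λ z → p * m + z) (λ _ → cong (λ z → p * m + z)) (λ _ → ℕ.+-cancelˡ-≡ (p * m) _ _) zs)
           (occurrences-staircase-none p (ℕ.m≤m+n (p * m) x)) ⟩
    occurrences x zs + 0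
      ≡⟨ ℕ.+-identityʳ (occurrences x zs) ⟩
    occurrences x zs ∎
    where open ≡-Reasoning

  staircase-irredundant : ∀ p x → ¬ Redundant m x (staircase m p)
  staircase-irredundant zero    x (inj₁ ())
  staircase-irredundant zero    x (inj₂ ())
  staircase-irredundant (suc p) x red with x ≟ p * m
  staircase-irredundant (suc p) x (inj₂ (_ , m∤x)) | yes refl = m∤x (divides-refl p)
  staircase-irredundant (suc p) x (inj₁ 1<n) | yes refl = ℕ.<-irrefl refl
    (subst (1 <_) (≡.trans (occurrences-here (p * m) (staircase m p)) (cong suc (occurrences-staircase-none p ℕ.≤-refl))) 1<n)
  staircase-irredundant (suc p) x red | no x≢ =
    staircase-irredundant p x (Sum.map (subst (1 <_) n≡) (λ { (eq , m∤x) → ≡.trans (sym n≡) eq , m∤x }) red)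
    where n≡ = occurrences-there (staircase m p) x≢

  -- Shifted entries are at least p m and staircase entries lie below, so the counts do not mix; the
  -- staircase alone consists of single multiples of m.
  redundant-padRoots : ∀ p {x zs} → Redundant m x (padRoots p zs) → ∃[ y ] x ≡ p * m + y × Redundant m y zs
  redundant-padRoots p {x} {zs} red with p * m ≤? x
  ... | yes pm≤x = y , sym x≡ , Sum.map (subst (1 <_) n≡) (λ { (eq , m∤x) → ≡.trans (sym n≡) eq , m∤x ∘ ∣y }) red
    where
    y = x ∸ p * m
    x≡ : p * m + y ≡ x
    x≡ = ℕ.m+[n∸m]≡n pm≤x
    n≡ : occurrences x (padRoots p zs) ≡ occurrences y zs
    n≡ = ≡.trans (cong (λ x → occurrences x (padRoots p zs)) (sym x≡)) (occurrences-padRoots p y zs)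
    ∣y : m ∣ y → m ∣ x
    ∣y m∣y = subst (m ∣_) x≡ (∣m∣n⇒∣m+n (divides-refl p) m∣y)
  ... | no pm≰x = contradiction (Sum.map (subst (1 <_) n≡) (λ { (eq , m∤x) → ≡.trans (sym n≡) eq , m∤x }) red) (staircase-irredundant p x)
    where
    n≡ : occurrences x (padRoots p zs) ≡ occurrences x (staircase m p)
    n≡ = ≡.trans (occurrences-++ x (map (λ z → p * m + z) zs) (staircase m p))
      (cong (_+ occurrences x (staircase m p)) (cong length (List.filter-none (x ≟_)
        (ListAll.map⁺ (ListAll.universal (λ z x≡ → pm≰x (subst (p * m ≤_) (sym x≡) (ℕ.m≤m+n (p * m) z))) zs)))))

  ∈-staircase⁻ : ∀ p {y} → y ∈ˡ staircase m p → y < p * m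
  ∈-staircase⁻ (suc p) (here refl) = ℕ.m<n+m (p * m) (>-nonZero⁻¹ m)
  ∈-staircase⁻ (suc p) (there y∈)  = ℕ.<-trans (∈-staircase⁻ p y∈) (ℕ.m<n+m (p * m) (>-nonZero⁻¹ m))

  ∈-padRoots : ∀ p {y zs} → y ∈ˡ padRoots p zs → p * m ≤ y → ∃[ z ] y ≡ p * m + z × z ∈ˡ zs
  ∈-padRoots p {zs = zs} y∈ pm≤y with ∈-++⁻ (map (λ z → p * m + z) zs) y∈
  ... | inj₁ y∈map with z , z∈ , eq ← ∈-map⁻ (λ z → p * m + z) y∈map = z , eq , z∈
  ... | inj₂ y∈stair = contradiction pm≤y (ℕ.<⇒≱ (∈-staircase⁻ p y∈stair))

  -- A redundant entry of the padded list is a shifted one, so every multiple of m above it exceeds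
  -- p m and can be shifted back.
  good-padRoots : ∀ p {zs} → Good m zs → Good m (padRoots p zs)
  good-padRoots p {zs} good x t y red x<tm tm<y y∈
    with x′ , refl , red′ ← redundant-padRoots p {zs = zs} red
    with y′ , refl , y′∈ ← ∈-padRoots p y∈ (ℕ.≤-trans (ℕ.m≤m+n (p * m) x′) (ℕ.<⇒≤ (ℕ.<-trans x<tm tm<y)))
    = subst (1 <_) (≡.trans (sym (occurrences-padRoots p (u * m) zs)) (cong (λ s → occurrences s (padRoots p zs)) (sym tm≡)))
        (good x′ u y′ red′ (ℕ.+-cancelˡ-< (p * m) x′ (u * m) (subst (p * m + x′ <_) tm≡ x<tm))
                           (ℕ.+-cancelˡ-< (p * m) (u * m) y′ (subst (_< p * m + y′) tm≡ tm<y)) y′∈)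
    where
    u = t ∸ p
    tm≡ : t * m ≡ p * m + u * m
    tm≡ = ≡.trans (cong (_* m) (sym (ℕ.m+[n∸m]≡n (ℕ.<⇒≤ (ℕ.*-cancelʳ-< m p t (ℕ.≤-<-trans (ℕ.m≤m+n (p * m) x′) x<tm))))))
                  (ℕ.*-distribʳ-+ m p u)

  padded-roots-↭ : ∀ {n n′} (A : Board n) (B : Board n′) → Singleton m A → Singleton m B → RookEquivalent m A B →
    ∀ q p {zs} → n + q ≡ n′ + p → Roots m (reversedHeights B) zs →
    roots m (reversedHeights A ++ replicate q 0) ↭ map +_ (padRoots p zs)
  padded-roots-↭ A B singA singB equiv q p {zs} len rs =
    rootRooks-injective m (roots m hs) (map +_ (padRoots p zs)) lengths same-rooks
    where
    hs = reversedHeights A ++ replicate q 0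
    padded : roots m (reversedHeights B ++ replicate p 0) ≡ map +_ (padRoots p zs)
    padded = Roots⇒roots m (roots-pad p rs)
    length-reversedHeights : ∀ {n} (B : Board n) → length (reversedHeights B) ≡ n
    length-reversedHeights B = ≡.trans (List.length-reverse (toList (heights B))) (Vec.length-toList (heights B))
    length-padded : ∀ {n} (B : Board n) p → length (roots m (reversedHeights B ++ replicate p 0)) ≡ n + p
    length-padded B p = ≡.trans (length-roots m (reversedHeights B ++ replicate p 0))
      (≡.trans (List.length-++ (reversedHeights B)) (cong₂ _+_ (length-reversedHeights B) (List.length-replicate p)))
    lengths : length (roots m hs) ≡ length (map +_ (padRoots p zs))
    lengths = ≡.trans (length-padded A q) (≡.trans len (≡.trans (sym (length-padded B p)) (cong length padded)))
    rootRooks-padded : ∀ {n} (B : Board n) → Singleton m B → ∀ p k →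
      rootRooks m (roots m (reversedHeights B ++ replicate p 0)) k ≡ + r m k B
    rootRooks-padded B sing p k = ≡.trans (sym (rooks-roots m (reversedHeights B ++ replicate p 0) k))
      (≡.trans (rooks-pad (reversedHeights B) p k) (sym (rooks-board m B sing k)))
    same-rooks : rootRooks m (roots m hs) ≗ rootRooks m (map +_ (padRoots p zs))
    same-rooks k = ≡.trans (rootRooks-padded A singA q k) (≡.trans (cong +_ (equiv k))
      (≡.trans (sym (rootRooks-padded B singB p k)) (cong (λ l → rootRooks m l k) padded)))

  -- Non-negativity of the roots of the padded `A` is inherited: they rearrange those of the padded
  -- `B`.
  vertex-roots : ∀ {n n′} (A : Board n) (B : Board n′) → Singleton m A → Singleton m B → RookEquivalent m A B →
    ∀ q p {zs} → n + q ≡ n′ + p → Roots m (reversedHeights B) zs →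
    ∃[ ws ] Valid m ws × ws ↭ padRoots p zs × Roots m (reversedHeights A ++ replicate q 0) ws
  vertex-roots A B singA singB equiv q p len rs
    with ws , eq , perm ← ↭-map-inv +_ (↭-sym (padded-roots-↭ A B singA singB equiv q p len rs))
    = ws , chain⇒valid m Rs (chain-pad q (board-chain A singA)) , ↭-sym perm , Rs
    where Rs = roots⇒Roots m (reversedHeights A ++ replicate q 0) eq

  -- Vertices and walks obtained from arrangements

  boardOf : ∀ {hs} → Chain m hs → Board (length (reverse hs))
  boardOf {hs} chain = record
    { heights    = fromList (reverse hs)
    ; increasing = VecLinked.map (≼⇒≤ m) (fromList-linked (reverse-linked chain))
    }

  boardOf-singleton : ∀ {hs} (chain : Chain m hs) → Singleton m (boardOf chain)
  boardOf-singleton chain = VecLinked.map (≼⇒singleton m) (fromList-linked (reverse-linked chain))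

  reversedHeights-boardOf : ∀ {hs} (chain : Chain m hs) → reversedHeights (boardOf chain) ≡ hs
  reversedHeights-boardOf {hs} chain = ≡.trans (cong reverse (Vec.toList∘fromList (reverse hs))) (List.reverse-involutive hs)

  module _ {n} (B : Board n) (sing : Singleton m B) {zs : List ℕ} (rs : Roots m (reversedHeights B) zs) where

    open Vertex

    shuffle₁ : ∀ a n b → a + (n + b) ≡ n + (a + b)
    shuffle₁ = ℕ-Solver.solve-∀

    shuffle₂ : ∀ a n b → b + (n + a) ≡ n + (a + b)
    shuffle₂ = ℕ-Solver.solve-∀

    vertexOf : ∀ p {hs ws} → Roots m hs ws → Valid m ws → ws ↭ padRoots p zs → Vertex m B
    vertexOf p {hs} {ws} Rs val perm = record
      { board      = boardOf chain
      ; singleton  = boardOf-singleton chain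
      ; equivalent = λ k → ℤ.+-injective (begin
          + r m k (boardOf chain)                  ≡⟨ rooks-board m (boardOf chain) (boardOf-singleton chain) k ⟩
          rooks m (reversedHeights (boardOf chain)) k ≡⟨ cong (λ hs → rooks m hs k) (reversedHeights-boardOf chain) ⟩
          rooks m hs k                             ≡⟨ rooks-roots m hs k ⟩
          rootRooks m (roots m hs) k               ≡⟨ cong (λ l → rootRooks m l k) (Roots⇒roots m Rs) ⟩
          rootRooks m (map +_ ws) k                ≡⟨ rootRooks-↭ m (map⁺ +_ perm) k ⟩
          rootRooks m (map +_ (padRoots p zs)) k   ≡⟨ cong (λ l → rootRooks m l k) (Roots⇒roots m (roots-pad p rs)) ⟨
          rootRooks m (roots m (reversedHeights B ++ replicate p 0)) k ≡⟨ rooks-roots m (reversedHeights B ++ replicate p 0) k ⟨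
          rooks m (reversedHeights B ++ replicate p 0) k ≡⟨ rooks-pad (reversedHeights B) p k ⟩
          rooks m (reversedHeights B) k            ≡⟨ rooks-board m B sing k ⟨
          + r m k B                                ∎)
      }
      where
      open ≡-Reasoning
      chain = valid⇒chain m Rs val

    vertexOf-represents : ∀ p {hs ws} (Rs : Roots m hs ws) (val : Valid m ws) (perm : ws ↭ padRoots p zs) →
                          Represents (board (vertexOf p Rs val perm)) hs
    vertexOf-represents p Rs val perm = 0 , ≡.trans (List.++-identityʳ _) (reversedHeights-boardOf (valid⇒chain m Rs val))

    -- The inner vertices of the walk are built by `vertexOf`, but V and W are given with
    -- presentations of their own. Equal root lists force equal heights, so a final `_≋_` step
    -- reaches W.
    walk : ∀ p {hs ws hs′ ws′} (V : Vertex m B) → Represents (board V) hs → Roots m hs ws → ws ↭ padRoots p zs →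
           Star (Move m) ws ws′ → Roots m hs′ ws′ → ∀ W → Represents (board W) hs′ → Star (Step m B) V W
    walk p V repV Rs perm ε Rs′ W repW with refl ← roots-functional m Rs Rs′ =
      inj₁ (represents-≋ {B₁ = board V} {board W} repV repW) ◅ ε
    walk p {hs} V repV Rs perm (mv@(_ , val , s) ◅ path) Rs′ W repW =
      inj₂ (step s) ◅ walk p U repU RsU permU path Rs′ W repW
      where
      RsU = proj₂ (heightsOf m val)
      permU = trans (↭-sym (move-↭ m mv)) perm
      U = vertexOf p RsU val permU
      repU = vertexOf-represents p RsU val permU
      step : Swap _ _ ⊎ Swap _ _ → Adjacent (board V) (board U)
      step (inj₁ sw) = swap⇒adjacent m {B₁ = board V} {board U} sw Rs RsU repV repU
      step (inj₂ sw) = adjacent-sym {B₁ = board U} {board V}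
        (swap⇒adjacent m {B₁ = board U} {board V} sw RsU Rs repU repV)

    good⇒connected : Good m zs → GraphConnected m B
    good⇒connected good V W
      -- All three boards are brought to the width n + columns V + columns W, so that one p serves
      -- both V and W.
      with vs , valV , permV , RsV ← vertex-roots (board V) B (singleton V) sing (equivalent V)
             (n + columns W) (columns V + columns W) (shuffle₁ (columns V) n (columns W)) rs
         | ws , valW , permW , RsW ← vertex-roots (board W) B (singleton W) sing (equivalent W)
             (n + columns V) (columns V + columns W) (shuffle₂ (columns V) n (columns W)) rs
      = walk p V (n + columns W , refl) RsV permV
          (connected m (length vs) refl valV valW (trans permV (↭-sym permW)) (good-↭ m (↭-sym permV) (good-padRoots p good)))
          RsW W (n + columns V , refl)
      where p = columns V + columns W

-- The position of a multiple of m that occurs once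

at : List ℕ → ℕ → ℕ
at []      _       = 0
at (x ∷ l) zero    = x
at (x ∷ l) (suc q) = at l q

at-++ˡ : ∀ l {l′ q} → q < length l → at (l ++ l′) q ≡ at l q
at-++ˡ (x ∷ l) {q = zero}  _        = refl
at-++ˡ (x ∷ l) {q = suc q} (s≤s lt) = at-++ˡ l lt

at-++-∷ : ∀ l {x l′} → at (l ++ x ∷ l′) (length l) ≡ x
at-++-∷ []      = refl
at-++-∷ (y ∷ l) = at-++-∷ l

at-pad : ∀ l p → at (l ++ replicate p 0) ≗ at l
at-pad []      zero    q       = refl
at-pad []      (suc p) zero    = refl
at-pad []      (suc p) (suc q) = at-pad [] p q
at-pad (x ∷ l) p       zero    = refl
at-pad (x ∷ l) p       (suc q) = at-pad l p q

at-beyond : ∀ l {q} → length l ≤ q → at l q ≡ 0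
at-beyond []      _        = refl
at-beyond (x ∷ l) (s≤s le) = at-beyond l le

∈⇒at : ∀ {x l} → x ∈ˡ l → ∃[ q ] q < length l × at l q ≡ x
∈⇒at (here refl) = 0 , s≤s z≤n , refl
∈⇒at (there x∈) with q , lt , eq ← ∈⇒at x∈ = suc q , s≤s lt , eq

at-∈ : ∀ l {q} → q < length l → at l q ∈ˡ l
at-∈ (x ∷ l) {zero}  _        = here refl
at-∈ (x ∷ l) {suc q} (s≤s lt) = there (at-∈ l lt)

at-unique : ∀ {x q q′} l → ¬ (1 < occurrences x l) → q < length l → q′ < length l → at l q ≡ x → at l q′ ≡ x → q ≡ q′
at-unique {q = zero}  {zero}   (y ∷ l) _  _         _          _    _    = refl
at-unique {q = zero}  {suc q′} (y ∷ l) ≯1 _         (s≤s lt′)  refl eq′  =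
  contradiction (subst (1 <_) (sym (occurrences-here y l)) (s≤s (∈⇒occurrences (subst (_∈ˡ l) eq′ (at-∈ l lt′))))) ≯1
at-unique {q = suc q} {zero}   (y ∷ l) ≯1 (s≤s lt)  _          eq   refl =
  contradiction (subst (1 <_) (sym (occurrences-here y l)) (s≤s (∈⇒occurrences (subst (_∈ˡ l) eq (at-∈ l lt))))) ≯1
at-unique {x} {suc q} {suc q′} (y ∷ l) ≯1 (s≤s lt)  (s≤s lt′)  eq   eq′  = cong suc (at-unique l (≯1 ∘ more) lt lt′ eq eq′)
  where
  more : 1 < occurrences x l → 1 < occurrences x (y ∷ l)
  more 1<n with x ≟ y
  ... | yes refl = subst (1 <_) (sym (occurrences-here x l)) (ℕ.m<n⇒m<1+n 1<n)
  ... | no x≢y   = subst (1 <_) (sym (occurrences-there l x≢y)) 1<n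

-- Counting from the right and reading 0 past the left end makes this function independent of
-- padding, so boards of different widths become comparable.
heightsFromRight : ∀ {n} → Vec ℕ n → ℕ → ℕ
heightsFromRight C = at (reverse (toList C))

heightsFromRight-⊑₀ : ∀ {n N} {xs : Vec ℕ n} {ys : Vec ℕ N} → xs ⊑₀ ys → heightsFromRight xs ≗ heightsFromRight ys
heightsFromRight-⊑₀ same          q = refl
heightsFromRight-⊑₀ (pad {ys = ys} ⊑) q = ≡.trans (heightsFromRight-⊑₀ ⊑ q)
  (sym (≡.trans (cong (λ l → at l q) (List.unfold-reverse 0 (toList ys))) (at-pad (reverse (toList ys)) 1 q)))

length-reverse-toList : ∀ {n} (xs : Vec ℕ n) → length (reverse (toList xs)) ≡ n
length-reverse-toList xs = ≡.trans (List.length-reverse (toList xs)) (Vec.length-toList xs)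

lookup-fromRight : ∀ {n} (xs : Vec ℕ n) i → lookup xs i ≡ heightsFromRight xs (toℕ (opposite i))
lookup-fromRight {suc n} (x ∷ xs) Fin.zero    = sym (begin
  at (reverse (x ∷ toList xs)) (toℕ (Fin.fromℕ n))
    ≡⟨ cong₂ at (List.unfold-reverse x (toList xs)) (≡.trans (Fin.toℕ-fromℕ n) (sym (length-reverse-toList xs))) ⟩
  at (reverse (toList xs) ++ x ∷ []) (length (reverse (toList xs)))
    ≡⟨ at-++-∷ (reverse (toList xs)) ⟩
  x ∎)
  where open ≡-Reasoning
lookup-fromRight {suc n} (x ∷ xs) (Fin.suc i) = begin
  lookup xs i
    ≡⟨ lookup-fromRight xs i ⟩
  at (reverse (toList xs)) (toℕ (opposite i))
    ≡⟨ at-++ˡ (reverse (toList xs)) (ℕ.<-≤-trans (Fin.toℕ<n (opposite i)) (ℕ.≤-reflexive (sym (length-reverse-toList xs)))) ⟨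
  at (reverse (toList xs) ++ x ∷ []) (toℕ (opposite i))
    ≡⟨ cong₂ at (List.unfold-reverse x (toList xs)) (Fin.toℕ-inject₁ (opposite i)) ⟨
  at (reverse (x ∷ toList xs)) (toℕ (Fin.inject₁ (opposite i))) ∎
  where open ≡-Reasoning

Moved : (f g : ℕ → ℕ) → Set
Moved f g = ∃[ a ] ∃[ b ] ∃[ k ] 0 < k × f a ≡ g a + k × f b + k ≡ g b × (∀ q → q ≢ a → q ≢ b → f q ≡ g q)

moved-sym : ∀ {f g} → Moved f g → Moved g f
moved-sym (a , b , k , 0<k , eqᵃ , eqᵇ , rest) = b , a , k , 0<k , sym eqᵇ , sym eqᵃ , λ q ≢b ≢a → sym (rest q ≢a ≢b)

movesCells⇒moved : ∀ {N} (C₁ C₂ : Vec ℕ N) → MovesCells C₁ C₂ → Moved (heightsFromRight C₁) (heightsFromRight C₂)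
movesCells⇒moved {N} C₁ C₂ (i , j , k , 0<k , eqᵢ , eqⱼ , rest) =
  toℕ (opposite i) , toℕ (opposite j) , k , 0<k ,
  ≡.trans (sym (lookup-fromRight C₁ i)) (≡.trans eqᵢ (cong (_+ k) (lookup-fromRight C₂ i))) ,
  ≡.trans (cong (_+ k) (sym (lookup-fromRight C₁ j))) (≡.trans eqⱼ (lookup-fromRight C₂ j)) ,
  others
  where
  others : ∀ q → q ≢ toℕ (opposite i) → q ≢ toℕ (opposite j) → heightsFromRight C₁ q ≡ heightsFromRight C₂ q
  others q ≢i ≢j with q <? N
  ... | no q≮N = ≡.trans (beyond C₁) (sym (beyond C₂))
    where
    beyond : ∀ C → heightsFromRight C q ≡ 0
    beyond C = at-beyond (reverse (toList C)) (ℕ.≤-trans (ℕ.≤-reflexive (length-reverse-toList C)) (ℕ.≮⇒≥ q≮N))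
  ... | yes q<N = begin
    heightsFromRight C₁ q                  ≡⟨ cong (heightsFromRight C₁) q≡ ⟩
    heightsFromRight C₁ (toℕ (opposite l)) ≡⟨ lookup-fromRight C₁ l ⟨
    lookup C₁ l                            ≡⟨ rest l (λ { refl → ≢i q≡ }) (λ { refl → ≢j q≡ }) ⟩
    lookup C₂ l                            ≡⟨ lookup-fromRight C₂ l ⟩
    heightsFromRight C₂ (toℕ (opposite l)) ≡⟨ cong (heightsFromRight C₂) q≡ ⟨
    heightsFromRight C₂ q                  ∎
    where
    open ≡-Reasoning
    l = opposite (Fin.fromℕ< q<N)
    q≡ : q ≡ toℕ (opposite l)
    q≡ = sym (≡.trans (cong toℕ (Fin.opposite-involutive (Fin.fromℕ< q<N))) (Fin.toℕ-fromℕ< q<N))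

adjacent⇒moved : ∀ {n₁ n₂} (A : Board n₁) (B : Board n₂) → Adjacent A B →
                 Moved (heightsFromRight (heights A)) (heightsFromRight (heights B))
adjacent⇒moved A B (N , C₁ , C₂ , ⊑₁ , ⊑₂ , mv)
  with a , b , k , 0<k , eqᵃ , eqᵇ , rest ← movesCells⇒moved C₁ C₂ mv =
  a , b , k , 0<k ,
  ≡.trans (heightsFromRight-⊑₀ ⊑₁ a) (≡.trans eqᵃ (cong (_+ k) (sym (heightsFromRight-⊑₀ ⊑₂ a)))) ,
  ≡.trans (cong (_+ k) (heightsFromRight-⊑₀ ⊑₁ b)) (≡.trans eqᵇ (sym (heightsFromRight-⊑₀ ⊑₂ b))) ,
  λ q ≢a ≢b → ≡.trans (heightsFromRight-⊑₀ ⊑₁ q) (≡.trans (rest q ≢a ≢b) (sym (heightsFromRight-⊑₀ ⊑₂ q)))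

≋⇒≗ : ∀ {n₁ n₂} (A : Board n₁) (B : Board n₂) → A ≋ B → heightsFromRight (heights A) ≗ heightsFromRight (heights B)
≋⇒≗ A B (_ , _ , ⊑₁ , ⊑₂) q = ≡.trans (heightsFromRight-⊑₀ ⊑₁ q) (sym (heightsFromRight-⊑₀ ⊑₂ q))

-- f q is the height of the column q places from the right, and n m − (q + 1) m − f q
-- its root when numbered as in a board of n columns, which padding does not change.
-- At and Above say that this root is equal to σ m and less than σ m.
module Crossing (m : ℕ) .{{_ : NonZero m}} (n σ top : ℕ) (σm<top : σ * m < top) where

  Level : (ℕ → ℕ) → ℕ → ℕ
  Level f q = f q + m * suc q

  At : (ℕ → ℕ) → ℕ → Set
  At f q = Level f q + σ * m ≡ m * n

  Above : (ℕ → ℕ) → ℕ → Set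
  Above f q = m * n < Level f q + σ * m

  record Profile (f : ℕ → ℕ) : Set where
    field
      chain  : ∀ q → _≼_ m (f (suc q)) (f q)
      unique : ∀ {q q′} → At f q → At f q′ → q ≡ q′
      peak   : ∃[ q ] Level f q + top ≡ m * n

  -- In terms of roots: when the left neighbour is below σ m, the root at q is at most σ m, since
  -- roots cannot step over a multiple of m.
  above-pred : ∀ {f q} → Profile f → Above f (suc q) → ¬ At f q → Above f q
  above-pred {f} {q} prof above ¬at = ℕ.≤∧≢⇒< mn≤ (¬at ∘ sym)
    where
    open ℕ.≤-Reasoning
    mn≤ : m * n ≤ Level f q + σ * m
    -- In the first case column q stands so far left that even height 0 gives a root at most σ m. In
    -- the second, t m is the height at which column `suc q` would have the root σ m.
    mn≤ with n ≤? suc q + σ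
    ... | yes n≤ = begin
      m * n                    ≤⟨ ℕ.*-monoʳ-≤ m n≤ ⟩
      m * (suc q + σ)          ≡⟨ lemma m (suc q) σ ⟩
      m * suc q + σ * m        ≤⟨ ℕ.+-monoˡ-≤ (σ * m) (ℕ.m≤n+m (m * suc q) (f q)) ⟩
      Level f q + σ * m        ∎
      where
      lemma : ∀ m q σ → m * (q + σ) ≡ m * q + σ * m
      lemma = ℕ-Solver.solve-∀
    ... | no n≰ = begin
      m * n                                   ≡⟨ cong (m *_) n≡ ⟨
      m * (suc (suc q) + σ + t)               ≡⟨ lemma₂ m q σ t ⟩
      suc t * m + m * suc q + σ * m           ≤⟨ ℕ.+-monoˡ-≤ (σ * m) (ℕ.+-monoˡ-≤ (m * suc q) (Profile.chain prof q t tm<)) ⟩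
      Level f q + σ * m                       ∎
      where
      t = n ∸ (suc (suc q) + σ)
      n≡ : suc (suc q) + σ + t ≡ n
      n≡ = ℕ.m+[n∸m]≡n (ℕ.≰⇒> n≰)
      lemma₂ : ∀ m q σ t → m * (suc (suc q) + σ + t) ≡ suc t * m + m * suc q + σ * m
      lemma₂ = ℕ-Solver.solve-∀
      lemma₁ : ∀ m q σ t → m * (suc (suc q) + σ + t) ≡ t * m + (m * suc (suc q) + σ * m)
      lemma₁ = ℕ-Solver.solve-∀
      tm< : t * m < f (suc q)
      tm< = ℕ.+-cancelʳ-< (m * suc (suc q) + σ * m) (t * m) (f (suc q)) (begin-strict
        t * m + (m * suc (suc q) + σ * m) ≡⟨ lemma₁ m q σ t ⟨
        m * (suc (suc q) + σ + t)         ≡⟨ cong (m *_) n≡ ⟩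
        m * n                             <⟨ above ⟩
        Level f (suc q) + σ * m           ≡⟨ ℕ.+-assoc (f (suc q)) (m * suc (suc q)) (σ * m) ⟩
        f (suc q) + (m * suc (suc q) + σ * m) ∎)

  -- Start at a place q ≥ n, where the root is negative, and go right: roots stay below σ m until σ
  -- m is met, which happens at q₂ only.
  above-left : ∀ {g q₂} → Profile g → At g q₂ → ∀ d q → n ≤ q + d → q₂ < q → Above g q
  above-left {g} prof at₂ zero q n≤ _ = begin-strict
    m * n                   ≤⟨ ℕ.*-monoʳ-≤ m (ℕ.≤-trans n≤ (ℕ.≤-reflexive (ℕ.+-identityʳ q))) ⟩
    m * q                   <⟨ ℕ.*-monoʳ-< m (ℕ.n<1+n q) ⟩
    m * suc q               ≤⟨ ℕ.m≤n+m (m * suc q) (g q) ⟩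
    Level g q               ≤⟨ ℕ.m≤m+n (Level g q) (σ * m) ⟩
    Level g q + σ * m       ∎
    where open ℕ.≤-Reasoning
  above-left prof at₂ (suc d) q n≤ q₂<q = above-pred prof
    (above-left prof at₂ d (suc q) (ℕ.≤-trans n≤ (ℕ.≤-reflexive (ℕ.+-suc q d))) (ℕ.m<n⇒m<1+n q₂<q))
    (λ at → ℕ.<⇒≢ q₂<q (Profile.unique prof at₂ at))

  -- If the root σ m moved to the right, all roots up to its new place would be at
  -- most σ m in f, and the later ones could exceed σ m only through a second root
  -- σ m; so top would not occur.
  no-right-move : ∀ {f g q₁ q₂} → Profile f → Profile g → Moved f g → At f q₁ → At g q₂ → ¬ (q₂ < q₁)
  no-right-move {f} {g} {q₁} {q₂} pf pg (a , b , k , 0<k , eqᵃ , eqᵇ , rest) at₁ at₂ q₂<q₁ = peak-contradiction (Profile.peak pf)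
    where
    left : ∀ q → q₂ < q → Above g q
    left q = above-left pg at₂ n q (ℕ.m≤n+m n q)

    f≡g : ∀ {q} → f q ≡ g q → Level f q + σ * m ≡ Level g q + σ * m
    f≡g {q} eq = cong (λ h → h + m * suc q + σ * m) eq

    fa>ga : g a < f a
    fa>ga = subst (g a <_) (sym eqᵃ) (ℕ.m<m+n (g a) 0<k)

    -- Left of q₂ the roots of g are below σ m, so column q₁ must have gained cells.
    q₁≡b : q₁ ≡ b
    q₁≡b with q₁ ≟ b | q₁ ≟ a
    ... | yes eq | _        = eq
    ... | no ≢b  | no ≢a    = contradiction (≡.trans (sym at₁) (f≡g (rest q₁ ≢a ≢b))) (ℕ.<⇒≢ (left q₁ q₂<q₁))
    ... | no _   | yes refl = contradiction (ℕ.<-trans (left q₁ q₂<q₁) (ℕ.+-monoˡ-< (σ * m) (ℕ.+-monoˡ-< (m * suc q₁) fa>ga)))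
                                            (ℕ.<-irrefl (sym at₁))

    -- In f only q₁ has the root σ m, so column q₂ has changed, and the gaining column is already
    -- q₁.
    q₂≡a : q₂ ≡ a
    q₂≡a with q₂ ≟ a
    ... | yes eq = eq
    ... | no ≢a  = contradiction (Profile.unique pf (≡.trans (f≡g (rest q₂ ≢a λ eq → ℕ.<⇒≢ q₂<q₁ (≡.trans eq (sym q₁≡b)))) at₂) at₁) (ℕ.<⇒≢ q₂<q₁)

    right : ∀ d q → q + d ≡ q₂ → Above f q
    right zero q eq = subst (Above f) (sym q≡a) (subst (_< Level f a + σ * m) (subst (At g) q₂≡a at₂)
      (ℕ.+-monoˡ-< (σ * m) (ℕ.+-monoˡ-< (m * suc a) fa>ga)))
      where
      q≡a : q ≡ a
      q≡a = ≡.trans (sym (ℕ.+-identityʳ q)) (≡.trans eq q₂≡a)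
    right (suc d) q eq = above-pred pf (right d (suc q) (≡.trans (sym (ℕ.+-suc q d)) eq))
      (λ at → ℕ.<⇒≢ (ℕ.≤-<-trans (ℕ.≤-trans (ℕ.m≤m+n q (suc d)) (ℕ.≤-reflexive eq)) q₂<q₁) (Profile.unique pf at at₁))

    -- No place is left for `top`: from q₂ rightwards f has only roots below σ m, at q₁ it has σ m,
    -- and elsewhere left of q₂ it agrees with g, whose roots there are below σ m.
    peak-contradiction : ¬ (∃[ q ] Level f q + top ≡ m * n)
    peak-contradiction (q , eq) = by-position (ℕ.<-cmp q q₂)
      where
      below : Level f q + σ * m < m * n
      below = subst (Level f q + σ * m <_) eq (ℕ.+-monoʳ-< (Level f q) σm<top)
      by-position : _ → _
      by-position (tri< q<q₂ _ _) = ℕ.<-asym below (right (q₂ ∸ q) q (ℕ.m+[n∸m]≡n (ℕ.<⇒≤ q<q₂)))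
      by-position (tri≈ _ q≡q₂ _) = ℕ.<-asym below (right 0 q (≡.trans (ℕ.+-identityʳ q) q≡q₂))
      by-position (tri> _ q≢q₂ q₂<q) with q ≟ q₁
      ... | yes refl = ℕ.<-irrefl at₁ below
      ... | no q≢q₁  = ℕ.<-asym below (subst (m * n <_) (sym (f≡g (rest q (λ eq → q≢q₂ (≡.trans eq (sym q₂≡a)))
                                                                          (λ eq → q≢q₁ (≡.trans eq (sym q₁≡b))))))
                                             (left q q₂<q))

  moved-fixes : ∀ {f g q₁ q₂} → Profile f → Profile g → Moved f g → At f q₁ → At g q₂ → q₁ ≡ q₂
  moved-fixes {q₁ = q₁} {q₂} pf pg mv at₁ at₂ with ℕ.<-cmp q₁ q₂
  ... | tri≈ _ eq _ = eq
  ... | tri< lt _ _ = contradiction lt (no-right-move pg pf (moved-sym mv) at₂ at₁)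
  ... | tri> _ _ gt = contradiction gt (no-right-move pf pg mv at₁ at₂)

-- Two vertices with a single entry in different places

module _ (m : ℕ) .{{_ : NonZero m}} where

  Closed : List ℕ → Set
  Closed l = ∀ {x} t → x ∈ˡ l → t * m ≤ x → t * m ∈ˡ l

  -- A multiple of m below e occurs further along the list, at a or after it; in descending order it
  -- is therefore at most a.
  descending-valid : ∀ {l} → AllPairs _≥_ l → Closed l → Valid m l
  descending-valid []             _  = []
  descending-valid ([] ∷ [])      cl with here refl ← cl 0 (here refl) z≤n = first
  descending-valid {e ∷ a ∷ l} (e≥ ∷ a≥ ∷ desc) cl = nxt ∷ descending-valid (a≥ ∷ desc) cl-tail
    where
    nxt : Next m a e
    nxt t tm<e = [ (λ tm≡a → ℕ.≤-reflexive tm≡a) , ListAll.lookup a≥ ]′ (split (∈-tail (cl t (here refl) (ℕ.<⇒≤ tm<e)) (ℕ.<⇒≢ tm<e)))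
      where
      split : t * m ∈ˡ a ∷ l → t * m ≡ a ⊎ t * m ∈ˡ l
      split (here eq)  = inj₁ eq
      split (there t∈) = inj₂ t∈
    cl-tail : Closed (a ∷ l)
    cl-tail {x} t x∈ tm≤x with t * m ≟ e
    ... | no tm≢e  = ∈-tail (cl t (there x∈) tm≤x) tm≢e
    ... | yes refl = subst (_∈ˡ a ∷ l) (ℕ.≤-antisym (ListAll.lookup e≥ x∈) tm≤x) x∈

  descending-remove : ∀ b {x c} → AllPairs _≥_ (b ++ x ∷ c) → AllPairs _≥_ (b ++ c) × ListAll.All (x ≥_) c
  descending-remove []      (x≥ ∷ desc) = desc , x≥
  descending-remove (y ∷ b) (y≥ ∷ desc) with desc′ , x≥ ← descending-remove b desc =
    (ListAll.++⁺ (ListAll.++⁻ˡ b y≥) (ListAll.tail (ListAll.++⁻ʳ b y≥)) ∷ desc′) , x≥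

  ∈-remove : ∀ b {x y c} → y ∈ˡ b ++ x ∷ c → y ≢ x → y ∈ˡ b ++ c
  ∈-remove b {x} {y} {c} y∈ y≢x = ∈-tail (∈-resp-↭ (shift x b c) y∈) y≢x

  -- A redundant multiple of m is repeated, so a copy stays; removing any other value costs no
  -- multiple.
  closed-remove : ∀ b {x c} → Redundant m x (b ++ x ∷ c) → Closed (b ++ x ∷ c) → Closed (b ++ c)
  closed-remove b {x} {c} red cl {y} t y∈ tm≤y with t * m ≟ x
  ... | no tm≢x  = ∈-remove b (cl t (∈-resp-↭ (↭-sym (shift x b c)) (there y∈)) tm≤y) tm≢x
  ... | yes refl = occurrences⇒∈ (b ++ c) (s≤s⁻¹ (subst (1 <_)
      (≡.trans (occurrences-↭ (t * m) (shift (t * m) b c)) (occurrences-here (t * m) (b ++ c))) (∣-redundant m {l = b ++ x ∷ c} (divides-refl t) red)))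

  -- The reversed order sorts downwards, so that the root vectors ascend from the first column to
  -- the last.
  open Sort (decTotalOrder ℕ.≤-decTotalOrder) using (sort; sort-↭; sort-↗)

  sort-descending : ∀ zs → AllPairs _≥_ (sort zs)
  sort-descending zs = Linked⇒AllPairs (λ x≥y y≥z → ℕ.≤-trans y≥z x≥y) (sort-↗ zs)

  TwoPositions : List ℕ → ℕ → Set
  TwoPositions zs s = ∃[ us ] ∃[ ws ] ∃[ q ] Valid m us × Valid m ws × us ↭ zs × ws ↭ zs ×
    suc q < length us × at us q ≡ s × at ws (suc q) ≡ s

  -- In the descending list the only entry s lies q places from the right, and
  -- moving a smaller redundant entry to the right end shifts it by one place.
  two-positions : ∀ {zs i s top} → Valid m zs → Redundant m i zs → s ∈ˡ zs → i < s → top ∈ˡ zs → s < top →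
    TwoPositions zs s
  two-positions {zs} {i} {s} {top} val red s∈ i<s top∈ s<top
    with b , c , eq ← ∈-∃++ (∈-resp-↭ (↭-sym (sort-↭ zs)) (redundant-∈ m red))
    = from-split b c (subst (AllPairs _≥_) eq (sort-descending zs)) (subst (_↭ zs) eq (sort-↭ zs))
    where
    from-split : ∀ b c → AllPairs _≥_ (b ++ i ∷ c) → b ++ i ∷ c ↭ zs → TwoPositions zs s
    from-split b c desc p = from-position (∈⇒at s∈b)
      where
      cl : Closed (b ++ i ∷ c)
      cl t x∈ tm≤x = ∈-resp-↭ (↭-sym p) (closed m val (∈-resp-↭ p x∈) t tm≤x)
      desc′ = proj₁ (descending-remove b desc)
      i≥c   = proj₂ (descending-remove b desc)
      s∈b : s ∈ˡ b
      s∈b = [ (λ s∈b → s∈b) , (λ s∈ic → contradiction (ListAll.lookup i≥c (∈-tail s∈ic (ℕ.>⇒≢ i<s))) (ℕ.<⇒≱ i<s)) ]′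
              (∈-++⁻ b (∈-resp-↭ (↭-sym p) s∈))
      top∈′ : top ∈ˡ b ++ c
      top∈′ = ∈-remove b (∈-resp-↭ (↭-sym p) top∈) (ℕ.>⇒≢ (ℕ.<-trans i<s s<top))
      moved-valid : ∀ l → b ++ c ≡ l → Valid m (i ∷ l)
      moved-valid []      eq with () ← subst (top ∈ˡ_) eq top∈′
      moved-valid (a ∷ l) eq = (λ t tm<i → ℕ.≤-trans (ℕ.<⇒≤ tm<i) (ℕ.≤-trans (ℕ.<⇒≤ (ℕ.<-trans i<s s<top)) (head≥ (subst (top ∈ˡ_) eq top∈′))))
        ∷ subst (Valid m) eq (descending-valid desc′ (closed-remove b (redundant-↭ m (↭-sym p) red) cl))
        where
        head≥ : top ∈ˡ a ∷ l → top ≤ a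
        head≥ (here refl)  = ℕ.≤-refl
        head≥ (there top∈) = ListAll.lookup (AllPairs.head (subst (AllPairs _≥_) eq desc′)) top∈

      from-position : ∃[ q ] q < length b × at b q ≡ s → TwoPositions zs s
      from-position (q , q<b , at≡) =
        b ++ i ∷ c , i ∷ b ++ c , q ,
        descending-valid desc cl , moved-valid (b ++ c) refl , p , trans (↭-sym (shift i b c)) p ,
        ℕ.<-≤-trans (s≤s q<b) (ℕ.≤-trans (ℕ.m≤m+n (suc (length b)) (length c))
          (ℕ.≤-reflexive (≡.trans (sym (ℕ.+-suc (length b) (length c))) (sym (List.length-++ b))))) ,
        ≡.trans (at-++ˡ b q<b) at≡ , ≡.trans (at-++ˡ b q<b) at≡

  roots-at : ∀ {hs zs q} → Roots m hs zs → q < length zs → at zs q + (at hs q + m * suc q) ≡ m * length zs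
  roots-at {h ∷ hs} {z ∷ zs} {zero} (eq ∷ rs) _ = begin
    z + (h + m * 1)      ≡⟨ ℕ.+-assoc z h (m * 1) ⟨
    z + h + m * 1        ≡⟨ cong (_+ m * 1) (≡.trans eq (cong (m *_) (roots-length m rs))) ⟩
    m * length zs + m * 1 ≡⟨ ℕ.*-distribˡ-+ m (length zs) 1 ⟨
    m * (length zs + 1)  ≡⟨ cong (m *_) (ℕ.+-comm (length zs) 1) ⟩
    m * suc (length zs)  ∎
    where open ≡-Reasoning
  roots-at {h ∷ hs} {z ∷ zs} {suc q} (eq ∷ rs) (s≤s lt) = begin
    at zs q + (at hs q + m * suc (suc q))   ≡⟨ shuffle (at zs q) (at hs q) m (suc q) ⟩
    m + (at zs q + (at hs q + m * suc q))   ≡⟨ cong (λ x → m + x) (roots-at rs lt) ⟩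
    m + m * length zs                       ≡⟨ ℕ.*-suc m (length zs) ⟨
    m * suc (length zs)                     ∎
    where
    open ≡-Reasoning
    shuffle : ∀ z h m q → z + (h + m * suc q) ≡ m + (z + (h + m * q))
    shuffle = ℕ-Solver.solve-∀

  chain-at : ∀ {hs} → Chain m hs → ∀ q → _≼_ m (at hs (suc q)) (at hs q)
  chain-at []            q       t ()
  chain-at [-]           q       t ()
  chain-at (h≽ ∷ chain)  zero    = h≽
  chain-at (h≽ ∷ chain)  (suc q) = chain-at chain q

  module _ {n} (B : Board n) (sing : Singleton m B) {zs : List ℕ} (rs : Roots m (reversedHeights B) zs)
           {σ top : ℕ} (σ∈ : σ * m ∈ˡ zs) (single : ¬ (1 < occurrences (σ * m) zs))
           (top∈ : top ∈ˡ zs) (σm<top : σ * m < top) where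

    open Crossing m n σ top σm<top
    open Vertex

    heightsOfVertex : Vertex m B → ℕ → ℕ
    heightsOfVertex V = heightsFromRight (heights (board V))

    module _ (V : Vertex m B) where

      private
        f   = heightsOfVertex V
        p   = columns V
        found = vertex-roots m (board V) B (singleton V) sing (equivalent V) n p (ℕ.+-comm (columns V) n) rs
        ws   = proj₁ found
        val  = proj₁ (proj₂ found)
        perm = proj₁ (proj₂ (proj₂ found))
        Rs   = proj₂ (proj₂ (proj₂ found))

        length-ws : length ws ≡ n + p
        length-ws = begin
          length ws                                         ≡⟨ roots-length m Rs ⟨
          length (reversedHeights (board V) ++ replicate n 0) ≡⟨ List.length-++ (reversedHeights (board V)) ⟩
          length (reversedHeights (board V)) + length (replicate n 0)
            ≡⟨ cong₂ _+_ (length-reverse-toList (heights (board V))) (List.length-replicate n) ⟩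
          p + n                                             ≡⟨ ℕ.+-comm p n ⟩
          n + p                                             ∎
          where open ≡-Reasoning

        root-level : ∀ {q} → q < length ws → at ws q + Level f q ≡ m * n + p * m
        root-level {q} lt = begin
          at ws q + (f q + m * suc q)
            ≡⟨ cong (λ h → at ws q + (h + m * suc q)) (at-pad (reversedHeights (board V)) n q) ⟨
          at ws q + (at (reversedHeights (board V) ++ replicate n 0) q + m * suc q)
            ≡⟨ roots-at Rs lt ⟩
          m * length ws      ≡⟨ cong (m *_) length-ws ⟩
          m * (n + p)        ≡⟨ ℕ.*-distribˡ-+ m n p ⟩
          m * n + m * p      ≡⟨ cong (λ c → m * n + c) (ℕ.*-comm m p) ⟩
          m * n + p * m      ∎
          where open ≡-Reasoning

        -- The p m added by padding cancels: the place of x is expressed through the width n of `B`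
        -- alone, which is the same for all vertices.
        at⇒level : ∀ {q x} → q < length ws → at ws q ≡ p * m + x → Level f q + x ≡ m * n
        at⇒level {q} {x} lt eq = ℕ.+-cancelʳ-≡ (p * m) _ _ (begin
          Level f q + x + p * m   ≡⟨ shuffle (Level f q) x (p * m) ⟩
          p * m + x + Level f q   ≡⟨ cong (_+ Level f q) eq ⟨
          at ws q + Level f q     ≡⟨ root-level lt ⟩
          m * n + p * m           ∎)
          where
          open ≡-Reasoning
          shuffle : ∀ l x c → l + x + c ≡ c + x + l
          shuffle = ℕ-Solver.solve-∀

        level⇒at : ∀ {q x} → q < length ws → Level f q + x ≡ m * n → at ws q ≡ p * m + x
        level⇒at {q} {x} lt eq = ℕ.+-cancelʳ-≡ (Level f q) _ _ (begin
          at ws q + Level f q     ≡⟨ root-level lt ⟩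
          m * n + p * m           ≡⟨ cong (_+ p * m) eq ⟨
          Level f q + x + p * m   ≡⟨ shuffle (Level f q) x (p * m) ⟩
          p * m + x + Level f q   ∎)
          where
          open ≡-Reasoning
          shuffle : ∀ l x c → l + x + c ≡ c + x + l
          shuffle = ℕ-Solver.solve-∀

        at-inside : ∀ {q} → At f q → q < length ws
        at-inside {q} eq = ℕ.<-≤-trans (ℕ.*-cancelˡ-≤ m (begin
          m * suc q                 ≤⟨ ℕ.m≤n+m (m * suc q) (f q) ⟩
          Level f q                 ≤⟨ ℕ.m≤m+n (Level f q) (σ * m) ⟩
          Level f q + σ * m         ≡⟨ eq ⟩
          m * n                     ∎)) (ℕ.≤-trans (ℕ.m≤m+n n p) (ℕ.≤-reflexive (sym length-ws)))
          where open ℕ.≤-Reasoning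

        level-of : ∀ {x} → x ∈ˡ zs → ∃[ q ] Level f q + x ≡ m * n
        level-of {x} x∈ with q , lt , eq ← ∈⇒at (∈-resp-↭ (↭-sym perm) (∈-++⁺ˡ (∈-map⁺ (λ z → p * m + z) x∈))) =
          q , at⇒level lt eq

      at-exists : ∃[ q ] At f q
      at-exists = level-of σ∈

      profile : Profile f
      profile = record
        { chain  = chain-at (board-chain m (board V) (singleton V))
        ; unique = λ at at′ → at-unique ws
            (single ∘ subst (1 <_) (≡.trans (occurrences-↭ (p * m + σ * m) perm) (occurrences-padRoots m p (σ * m) zs)))
            (at-inside at) (at-inside at′) (level⇒at (at-inside at) at) (level⇒at (at-inside at′) at′)
        ; peak   = level-of top∈
        }

    step-fixes : ∀ {V W q} → Step m B V W → At (heightsOfVertex V) q → At (heightsOfVertex W) q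
    step-fixes {V} {W} {q} (inj₁ V≋W) at₁ =
      ≡.trans (cong (λ h → h + m * suc q + σ * m) (sym (≋⇒≗ (board V) (board W) V≋W q))) at₁
    step-fixes {V} {W} (inj₂ adj) at₁ = subst (At (heightsOfVertex W))
      (sym (moved-fixes (profile V) (profile W) (adjacent⇒moved (board V) (board W) adj) at₁ (proj₂ (at-exists W))))
      (proj₂ (at-exists W))

    path-fixes : ∀ {V W q} → Star (Step m B) V W → At (heightsOfVertex V) q → At (heightsOfVertex W) q
    path-fixes ε                             at₁ = at₁
    path-fixes (_◅_ {V} {W} step path) at₁ = path-fixes path (step-fixes {V} {W} step at₁)

    vertexAt : ∀ {us} → Valid m us → us ↭ zs → ∃[ V ] ∀ q → q < length us → at us q ≡ σ * m → At (heightsOfVertex V) q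
    vertexAt {us} val p = V , λ q lt eq → (begin
      Level (heightsOfVertex V) q + σ * m
        ≡⟨ cong (λ hs → at hs q + m * suc q + σ * m) (reversedHeights-boardOf m (valid⇒chain m Rs val)) ⟩
      at hs q + m * suc q + σ * m
        ≡⟨ ℕ.+-comm (at hs q + m * suc q) (σ * m) ⟩
      σ * m + (at hs q + m * suc q)
        ≡⟨ cong (_+ (at hs q + m * suc q)) eq ⟨
      at us q + (at hs q + m * suc q)
        ≡⟨ roots-at Rs lt ⟩
      m * length us
        ≡⟨ cong (m *_) (≡.trans (↭-length p) (≡.trans (sym (roots-length m rs)) (length-reverse-toList (heights B)))) ⟩
      m * n ∎)
      where
      open ≡-Reasoning
      hs = proj₁ (heightsOf m val)
      Rs = proj₂ (heightsOf m val)
      V  = vertexOf m B sing rs 0 Rs val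
             (trans p (↭-reflexive (sym (≡.trans (List.++-identityʳ (map (λ z → z) zs)) (List.map-id zs)))))

    -- Along a path the place of σ m is fixed, so W would have it both at q and at `suc q`.
    disconnected : ∀ {i} → Valid m zs → Redundant m i zs → i < σ * m → ¬ GraphConnected m B
    disconnected val red i<σm conn
      with us , ws , q , val-u , val-w , p-u , p-w , q+1< , at-u , at-w ← two-positions val red σ∈ i<σm top∈ σm<top
      = ℕ.1+n≢n (Profile.unique (profile W)
          (at-W (suc q) (subst (suc q <_) (≡.trans (↭-length p-u) (sym (↭-length p-w))) q+1<) at-w)
          (path-fixes (conn V W) (at-V q (ℕ.<-trans (ℕ.n<1+n q) q+1<) at-u)))
      where
      V    = proj₁ (vertexAt val-u p-u)
      at-V = proj₂ (vertexAt val-u p-u)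
      W    = proj₁ (vertexAt val-w p-w)
      at-W = proj₂ (vertexAt val-w p-w)

theorem21 : (m : ℕ) .{{_ : NonZero m}} (n : ℕ) (B : Board n) →
    Singleton m B →
    All (0ℤ ≤ᶻ_) (ξ m B) →
    (M : ℤ) → IsGreatest (λ k → v m B k ≢ 0) M →
    (i : ℕ) → IsLeast (λ k → v m B (+ k) > 1 ⊎ (v m B (+ k) ≡ 1 × ¬ (m ∣ k))) i →
    GraphConnected m B ⇔ (∀ (s : ℕ) → s ∈ S m M → i < s → v m B (+ s) ≥ 2)
theorem21 m n B sing nneg M (vM≢0 , greatest) i (v-i , least)
  with zs , rs ← board-roots m B nneg
  with top , refl , top∈ ← v-entry m B rs M vM≢0
  = mk⇔ necessary (λ cond → good⇒connected m B sing rs (good cond))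
  where
  v≡ : ∀ x → v m B (+ x) ≡ occurrences x zs
  v≡ = v-occurrences m B rs

  valid : Valid m zs
  valid = chain⇒valid m rs (board-chain m B sing)

  red-i : Redundant m i zs
  red-i = Sum.map (subst (1 <_) (v≡ i)) (λ { (eq , m∤i) → ≡.trans (sym (v≡ i)) eq , m∤i }) v-i

  i-least : ∀ x → Redundant m x zs → i ≤ x
  i-least x red = least x (Sum.map (subst (1 <_) (sym (v≡ x))) (λ { (eq , m∤x) → ≡.trans (v≡ x) eq , m∤x }) red)

  top-greatest : ∀ {y} → y ∈ˡ zs → y ≤ top
  top-greatest {y} y∈ = ℤ.drop‿+≤+ (greatest (+ y) λ v≡0 →
    ℕ.<⇒≢ (∈⇒occurrences y∈) (sym (≡.trans (sym (v≡ y)) v≡0)))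

  good : (∀ s → s ∈ S m (+ top) → i < s → v m B (+ s) ≥ 2) → Good m zs
  good cond x t y red x<tm tm<y y∈ = subst (1 <_) (v≡ (t * m))
    (cond (t * m) (divides-refl t , ℤ.+<+ (ℕ.<-≤-trans tm<y (top-greatest y∈))) (ℕ.≤-<-trans (i-least x red) x<tm))

  necessary : GraphConnected m B → ∀ s → s ∈ S m (+ top) → i < s → v m B (+ s) ≥ 2
  necessary conn s (divides σ refl , s<M) i<s with 1 <? occurrences s zs
  ... | yes 1<n  = subst (1 <_) (sym (v≡ s)) 1<n
  -- Being a multiple of m below the entry `top`, s occurs; violating the bound thus means occurring
  -- exactly once.
  ... | no  ≯1 = contradiction conn
    (disconnected m B sing rs {σ} (closed m valid top∈ σ (ℕ.<⇒≤ (ℤ.drop‿+<+ s<M))) ≯1 top∈ (ℤ.drop‿+<+ s<M) valid red-i i<s)
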